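{- Let $k\ge1$ be a fixed integer and $t\ge1$ an integer. Let $G$ be a connected graph with $n$ vertices and $m$ edges having a (multiplicative) $t$-spanner with tree-width $k-1$. Then $G$ admits a system $\mathcal{T}(G)$ of at most $k(1+\log_2 n)$ collective additive tree $(2\lceil t/2\rceil(1+\log_2 n))$-spanners, constructible in polynomial time (for every fixed $k$).
   Context: Graphs are finite, connected, unweighted, undirected and simple; $d_G$ is the shortest-path distance. A spanning subgraph $H$ of $G$ is a (multiplicative) $t$-spanner if $d_H(u,v)\le t\cdot d_G(u,v)$ for all vertices $u,v$. Tree-width is the usual Robertson–Seymour tree-width (minimum over tree-decompositions of the maximum bag size minus one). A graph $G$ admits a system of $\mu$ collective additive tree $r$-spanners if there is a set $\mathcal{T}(G)$ of at most $\mu$ spanning trees of $G$ such that for any two vertices $x,y$ some $T\in\mathcal{T}(G)$ satisfies $d_T(x,y)\le d_G(x,y)+r$. -}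

module Defs where

open import Data.Bool.Base using (Bool; true; false; T)
open import Data.Fin.Base using (Fin)
import Data.Fin.Subset as Subset
open Subset using (Subset; ∣_∣; _∩_; _⊆_)
open import Data.List.Base using (List; []; _∷_; length; map; tabulate)
open import Data.List.Extrema.Nat using (max)
open import Data.List.Membership.Propositional using (_∈_)
open import Data.List.Relation.Unary.All using (All)
open import Data.List.Relation.Unary.Any using (Any)
open import Data.List.Relation.Unary.Unique.Propositional using (Unique)
open import Data.Nat.Base
open import Data.Nat.Logarithm using (⌊log₂_⌋)
open import Data.Product.Base using (Σ-syntax; ∃-syntax; _×_; _,_; proj₁; proj₂)
open import Relation.Binary.PropositionalEquality.Core using (_≡_)
open import Relation.Nullary.Negation.Core using (¬_)

------------------------------------------------------------------------
-- Graphs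

record Graph (n : ℕ) : Set where
  field
    adj    : Fin n → Fin n → Bool
    sym    : ∀ u v → adj u v ≡ adj v u
    irrefl : ∀ u → adj u u ≡ false

open Graph public using (adj)

Adj : ∀ {n} → Graph n → Fin n → Fin n → Set
Adj G u v = T (adj G u v)

data Walk {n} (G : Graph n) : Fin n → Fin n → Set where
  stop : ∀ {u} → Walk G u u
  step : ∀ {u v w} → Adj G u v → Walk G v w → Walk G u w

module _ {n} {G : Graph n} where

  edges : ∀ {u v} → Walk G u v → ℕ
  edges stop       = 0
  edges (step _ p) = suc (edges p)

  vertices : ∀ {u v} → Walk G u v → List (Fin n)
  vertices {u} stop       = u ∷ []
  vertices {u} (step _ p) = u ∷ vertices p

  IsPath : ∀ {u v} → Walk G u v → Set
  IsPath p = Unique (vertices p)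

-- d_G(u,v) = d.  No d qualifies when u and v lie in different components;
-- a shortest walk is automatically a path.
Dist : ∀ {n} → Graph n → Fin n → Fin n → ℕ → Set
Dist G u v d =
  (Σ[ p ∈ Walk G u v ] edges p ≡ d) × (∀ (p : Walk G u v) → d ≤ edges p)

-- The graph on no vertices is not connected.
Connected : ∀ {n} → Graph n → Set
Connected {n} G = NonZero n × (∀ u v → Walk G u v)

-- A cycle is a path with at least two edges, closed up by a further edge.
Acyclic : ∀ {n} → Graph n → Set
Acyclic G =
  ∀ {u v} (p : Walk G u v) → IsPath p → 2 ≤ edges p → ¬ Adj G v u

IsTree : ∀ {n} → Graph n → Set
IsTree G = Connected G × Acyclic G

SpanningSubgraph : ∀ {n} → Graph n → Graph n → Set
SpanningSubgraph H G = ∀ u v → Adj H u v → Adj G u v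

SpanningTree : ∀ {n} → Graph n → Graph n → Set
SpanningTree T G = SpanningSubgraph T G × IsTree T

IsSpanner : ∀ {n} → ℕ → Graph n → Graph n → Set
IsSpanner t G H =
  SpanningSubgraph H G ×
  (∀ u v d → Dist G u v d → ∃[ e ] Dist H u v e × e ≤ t * d)

------------------------------------------------------------------------
-- Tree-width

record TreeDecomposition {n} (G : Graph n) : Set where
  field
    {size}        : ℕ
    tree          : Graph size
    isTree        : IsTree tree
    bag           : Fin size → Subset n
    covers-vertex : ∀ v → ∃[ i ] v Subset.∈ bag i
    covers-edge   : ∀ u v → Adj G u v →
                    ∃[ i ] u Subset.∈ bag i × v Subset.∈ bag i
    coherent      : ∀ {i l} (p : Walk tree i l) → IsPath p →
                    ∀ {j} → j ∈ vertices p → bag i ∩ bag l ⊆ bag j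

  -- For n ≥ 1 some bag is non-empty, so the subtraction does not truncate.
  width : ℕ
  width = max 0 (tabulate (λ i → ∣ bag i ∣)) ∸ 1

HasTreeWidth : ∀ {n} → Graph n → ℕ → Set
HasTreeWidth G w =
  (Σ[ D ∈ TreeDecomposition G ] TreeDecomposition.width D ≡ w) ×
  (∀ (D : TreeDecomposition G) → w ≤ TreeDecomposition.width D)

------------------------------------------------------------------------
-- Collective additive tree spanners

IsCollectiveSystem : ∀ {n} → Graph n → (μ r : ℕ) → List (Graph n) → Set
IsCollectiveSystem G μ r 𝒯 =
  length 𝒯 ≤ μ ×
  All (λ T → SpanningTree T G) 𝒯 ×
  (∀ x y d → Dist G x y d →
     Any (λ T → ∃[ e ] Dist T x y e × e ≤ d + r) 𝒯)

-- The integer part of the real number c (1 + log₂ n) = log₂ ((2 n)ᶜ), for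
-- n ≥ 1.  Bounding an integer by that real number is the same as bounding it
-- by its integer part.  This is in general larger than c * (1 + ⌊log₂ n ⌋).
⌊_·[1+log₂_]⌋ : ℕ → ℕ → ℕ
⌊ c ·[1+log₂ n ]⌋ = ⌊log₂ (2 * n) ^ c ⌋

------------------------------------------------------------------------
-- A programming language with a cost semantics

infixr 7 _⊗_

data Ty : Set where
  bool : Ty
  list : Ty → Ty
  _⊗_  : Ty → Ty → Ty

⟦_⟧ : Ty → Set
⟦ bool ⟧  = Bool
⟦ list σ ⟧ = List ⟦ σ ⟧
⟦ σ ⊗ τ ⟧ = ⟦ σ ⟧ × ⟦ τ ⟧

infixr 9 _∙_

-- In the last three constructors, ρ is the type of a parameter that remains
-- accessible to the branches and to the body of the loop.
data Prog : Ty → Ty → Set where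
  id    : ∀ {σ} → Prog σ σ
  _∙_   : ∀ {ρ σ τ} → Prog σ τ → Prog ρ σ → Prog ρ τ
  ⟨_,_⟩ : ∀ {ρ σ τ} → Prog ρ σ → Prog ρ τ → Prog ρ (σ ⊗ τ)
  fst   : ∀ {σ τ} → Prog (σ ⊗ τ) σ
  snd   : ∀ {σ τ} → Prog (σ ⊗ τ) τ
  const : ∀ {ρ} → Bool → Prog ρ bool
  nil   : ∀ {ρ σ} → Prog ρ (list σ)
  cons  : ∀ {σ} → Prog (σ ⊗ list σ) (list σ)
  cond  : ∀ {ρ τ} → Prog ρ τ → Prog ρ τ → Prog (bool ⊗ ρ) τ
  match : ∀ {ρ σ τ} → Prog ρ τ → Prog ((σ ⊗ list σ) ⊗ ρ) τ →
          Prog (list σ ⊗ ρ) τ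
  fold  : ∀ {ρ σ τ} → Prog ρ τ → Prog ((σ ⊗ τ) ⊗ ρ) τ →
          Prog (list σ ⊗ ρ) τ

eval : ∀ {σ τ} → Prog σ τ → ⟦ σ ⟧ → ⟦ τ ⟧
eval id          x                 = x
eval (g ∙ f)     x                 = eval g (eval f x)
eval ⟨ f , g ⟩   x                 = eval f x , eval g x
eval fst         (x , _)           = x
eval snd         (_ , y)           = y
eval (const b)   _                 = b
eval nil         _                 = []
eval cons        (x , xs)          = x ∷ xs
eval (cond f g)  (true  , p)       = eval f p
eval (cond f g)  (false , p)       = eval g p
eval (match f g) ([]     , p)      = eval f p
eval (match f g) (x ∷ xs , p)      = eval g ((x , xs) , p)
eval (fold f g)  ([]     , p)      = eval f p
eval (fold f g)  (x ∷ xs , p)      = eval g ((x , eval (fold f g) (xs , p)) , p)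

-- The number of steps of call-by-value evaluation.  Pairs and list cells are
-- pointers, so that each primitive takes constant time and copying a value is
-- free; a machine pays a constant per step.  Every polynomial-time function can
-- be programmed: a clock of nᶜ ticks is c nested folds over the input.
-- Conversely, a program with polynomial cost whose output has polynomial size
-- runs in polynomial time on a Turing machine.
cost : ∀ {σ τ} → Prog σ τ → ⟦ σ ⟧ → ℕ
cost id          x            = 1
cost (g ∙ f)     x            = suc (cost f x + cost g (eval f x))
cost ⟨ f , g ⟩   x            = suc (cost f x + cost g x)
cost fst         x            = 1
cost snd         x            = 1
cost (const b)   x            = 1
cost nil         x            = 1
cost cons        x            = 1
cost (cond f g)  (true  , p)  = suc (cost f p)
cost (cond f g)  (false , p)  = suc (cost g p)
cost (match f g) ([]     , p) = suc (cost f p)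
cost (match f g) (x ∷ xs , p) = suc (cost g ((x , xs) , p))
cost (fold f g)  ([]     , p) = suc (cost f p)
cost (fold f g)  (x ∷ xs , p) =
  suc (cost (fold f g) (xs , p) + cost g ((x , eval (fold f g) (xs , p)) , p))

matrix : Ty
matrix = list (list bool)

encode : ∀ {n} → Graph n → ⟦ matrix ⟧
encode G = tabulate (λ u → tabulate (λ v → adj G u v))

-- On the adjacency matrix of G, the program P outputs the adjacency matrices
-- of the members of such a system, within c nᶜ steps.  A family of graphs on
-- n ≥ 1 vertices is treated in polynomial time iff one P and one c serve for
-- all its members (the number of edges is less than n²).
Constructs : ∀ {n} → Prog matrix (list matrix) → (c : ℕ) →
             Graph n → (μ r : ℕ) → Set
Constructs {n} P c G μ r =
  Σ[ 𝒯 ∈ List (Graph n) ]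
    IsCollectiveSystem G μ r 𝒯 ×
    eval P (encode G) ≡ map encode 𝒯 ×
    cost P (encode G) ≤ c * n ^ c

-- Let ρ = ⌈t/2⌉ and let C be a set of vertices of G.  If i is a node of the
-- tree-decomposition of the spanner H that minimises the sum of the distances
-- from i to bags of the vertices of C, then no branch at i has more than half
-- of C.  A component of C minus the disks of radius ρ (in G) around the at most
-- k vertices of bag i lies in one branch: an edge of G is replaced in H by a
-- path with at most t edges, and if that meets bag i, then one end of the edge
-- is in a disk.  So C is halved by k disks of radius ρ, and brute force over all
-- k-tuples finds k disks of the least possible radius that halve C.
--
-- Start with A = V and repeatedly remove from every component of G[A] the k
-- disks found for it.  There are at most 1 + log₂ n rounds.  In each round, for
-- each of the k places in the tuple, take breadth-first trees in all components
-- of G[A], rooted at the centre in that place if it lies in the component, and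
-- extend this forest to a spanning tree of G.
--
-- A vertex w removed in round i, of a set A, lies within iρ of a centre b inside
-- G[B], where B ⊇ A is the active set of some round at which b was a centre.
-- Indeed a path of length at most ρ from w to its centre either stays in A, or
-- first leaves A at a vertex removed before.  A shortest path P from x to y that
-- loses its first vertex w in round i lies in A ⊆ B, hence the breadth-first
-- tree of b in G[B] joins x to y by a path with at most |P| + 2iρ edges.
module Submission where

open import Defs
open import Data.Bool.Base using (Bool; true; false; T; if_then_else_)
open import Data.Bool.Properties using (T?)
open import Data.Empty using (⊥-elim)
open import Data.Fin.Base using (Fin; zero; suc; toℕ)
open import Data.Fin.Properties using (_≟_; injective⇒≤; toℕ-injective; toℕ<n)
import Data.Fin.Subset as Subset
open import Data.Fin.Subset using (Subset; inside; outside; ∣_∣)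
open import Data.Fin.Subset.Properties using (x∈p∩q⁺)
open import Data.List.Base
  using (List; []; _∷_; _++_; drop; length; lookup; map; replicate; tabulate)
open import Data.List.Extrema.Nat using (max; xs≤max)
import Data.List.Membership.DecPropositional as DecMembership
open import Data.List.Membership.Propositional using (_∈_; _∉_; lose)
open import Data.List.Membership.Propositional.Properties
  using (∈-++⁺ˡ; ∈-lookup; ∈-map⁺; ∈-tabulate⁺)
open import Data.List.Properties
  using (length-++; length-map; length-replicate; length-tabulate; map-∘)
open import Data.List.Relation.Unary.All as All using (All; []; _∷_)
open import Data.List.Relation.Unary.All.Properties using (¬Any⇒All¬)
open import Data.List.Relation.Unary.Any using (Any; here; there)
open import Data.List.Relation.Unary.Unique.Propositional using (Unique; []; _∷_)
open import Data.Nat.Base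
open import Data.Nat.Logarithm using (⌊log₂_⌋; ⌊log₂⌋-mono-≤; ⌊log₂[2^n]⌋≡n)
open import Data.Nat.Properties hiding (_≟_)
open import Data.Nat.Solver using (module +-*-Solver)
open import Data.Product.Base using (Σ-syntax; ∃-syntax; _×_; _,_; proj₁; proj₂)
open import Data.Sum.Base using (_⊎_; inj₁; inj₂)
open import Data.Unit.Base using (tt)
open import Data.Vec.Base as Vec using ([]; _∷_)
open import Relation.Binary.Construct.Closure.ReflexiveTransitive using (Star; ε; _◅_)
open import Relation.Binary.PropositionalEquality
  using (_≡_; _≢_; refl; sym; trans; cong; cong₂; subst; subst₂)
open import Relation.Nullary using (¬_; yes; no; contradiction)
open +-*-Solver using (solve; _:+_; _:*_; _:=_; con)

-- Polynomial-time terms and their compilation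

data Type : Set where
  bool nat idx : Type
  vec list     : Type → Type
  _⊗_          : Type → Type → Type

Val : Type → ℕ → Set
Val bool     n = Bool
Val nat      n = ℕ
Val idx      n = Fin n
Val (vec τ)  n = Fin n → Val τ n
Val (list τ) n = List (Val τ n)
Val (σ ⊗ τ)  n = Val σ n × Val τ n

foldFin : ∀ {A : Set} m → (Fin m → A → A) → A → A
foldFin zero    f z = z
foldFin (suc m) f z = f zero (foldFin m (λ i → f (suc i)) z)

isZero : ℕ → Bool
isZero zero    = true
isZero (suc _) = false

-- Every iteration runs over `Fin n`: nothing recurses on a `nat` or a `list`, and `monus` takes
-- indices only. So the cost of a term is polynomial in n, with a bound that does not depend on the
-- data.
data Term : Type → Type → Set where
  id          : ∀ {Γ} → Term Γ Γ
  _∙_         : ∀ {Γ σ τ} → Term σ τ → Term Γ σ → Term Γ τ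
  ⟨_,_⟩       : ∀ {Γ σ τ} → Term Γ σ → Term Γ τ → Term Γ (σ ⊗ τ)
  fst         : ∀ {σ τ} → Term (σ ⊗ τ) σ
  snd         : ∀ {σ τ} → Term (σ ⊗ τ) τ
  const       : ∀ {Γ} → Bool → Term Γ bool
  cond        : ∀ {Γ τ} → Term Γ bool → Term Γ τ → Term Γ τ → Term Γ τ
  nil         : ∀ {Γ τ} → Term Γ (list τ)
  cons        : ∀ {τ} → Term (τ ⊗ list τ) (list τ)
  zeroₜ       : ∀ {Γ} → Term Γ nat
  sucₜ predₜ  : Term nat nat
  isZeroₜ     : Term nat bool
  monus       : Term (idx ⊗ idx) nat
  at          : ∀ {τ} → Term (vec τ ⊗ idx) τ
  tab         : ∀ {Γ τ} → Term (Γ ⊗ idx) τ → Term Γ (vec τ)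
  loop        : ∀ {Γ τ} → Term Γ τ → Term ((Γ ⊗ idx) ⊗ τ) τ → Term Γ τ

sem : ∀ {Γ τ n} → Term Γ τ → Val Γ n → Val τ n
sem id           γ       = γ
sem (f ∙ g)      γ       = sem f (sem g γ)
sem ⟨ f , g ⟩    γ       = sem f γ , sem g γ
sem fst          γ       = proj₁ γ
sem snd          γ       = proj₂ γ
sem (const b)    γ       = b
sem (cond c f g) γ       = if sem c γ then sem f γ else sem g γ
sem nil          γ       = []
sem cons         γ       = proj₁ γ ∷ proj₂ γ
sem zeroₜ        γ       = 0
sem sucₜ         γ       = suc γ
sem predₜ        γ       = pred γ
sem isZeroₜ      γ       = isZero γ
sem monus        γ       = toℕ (proj₁ γ) ∸ toℕ (proj₂ γ)
sem at           γ       = proj₁ γ (proj₂ γ)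
sem (tab f)      γ       = λ i → sem f (γ , i)
sem (loop {_} {_} z f) γ = foldFin _ (λ i x → sem f ((γ , i) , x)) (sem z γ)

ty : Type → Ty
ty bool     = bool
ty nat      = list bool
ty idx      = list bool
ty (vec τ)  = list (ty τ)
ty (list τ) = list (ty τ)
ty (σ ⊗ τ)  = ty σ ⊗ ty τ

enc : ∀ τ {n} → Val τ n → ⟦ ty τ ⟧
enc bool     b       = b
enc nat      m       = replicate m true
enc idx      i       = replicate (toℕ i) true
enc (vec τ)  f       = tabulate (λ i → enc τ (f i))
enc (list τ) xs      = map (enc τ) xs
enc (σ ⊗ τ)  (x , y) = enc σ x , enc τ y

indices : ∀ n → List (List Bool)
indices n = tabulate {n = n} (enc idx)

-- A value for `headₚ` on the empty list, a case that indices below n never reach.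
default : ∀ {ρ} σ → Prog ρ σ
default bool     = const false
default (list σ) = nil
default (σ ⊗ τ)  = ⟨ default σ , default τ ⟩

tailₚ : ∀ {σ} → Prog (list σ) (list σ)
tailₚ = match nil (snd ∙ fst) ∙ ⟨ id , id ⟩

headₚ : ∀ {σ} → Prog (list σ) σ
headₚ = match (default _) (fst ∙ fst) ∙ ⟨ id , id ⟩

dropₚ : ∀ {σ} → Prog (list bool ⊗ list σ) (list σ)
dropₚ = fold id (tailₚ ∙ (snd ∙ fst))

isNilₚ : ∀ {σ} → Prog (list σ) bool
isNilₚ = match (const true) (const false) ∙ ⟨ id , id ⟩

-- Programs carry the list of all indices as the first component of their input.
compile : ∀ {Γ τ} → Term Γ τ → Prog (list (list bool) ⊗ ty Γ) (ty τ)
compile id           = snd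
compile (f ∙ g)      = compile f ∙ ⟨ fst , compile g ⟩
compile ⟨ f , g ⟩    = ⟨ compile f , compile g ⟩
compile fst          = fst ∙ snd
compile snd          = snd ∙ snd
compile (const b)    = const b
compile (cond c f g) = cond (compile f) (compile g) ∙ ⟨ compile c , id ⟩
compile nil          = nil
compile cons         = cons ∙ snd
compile zeroₜ        = nil
compile sucₜ         = cons ∙ ⟨ const true , snd ⟩
compile predₜ        = tailₚ ∙ snd
compile isZeroₜ      = isNilₚ ∙ snd
compile monus        = dropₚ ∙ (⟨ snd , fst ⟩ ∙ snd)
compile at           = headₚ ∙ (dropₚ ∙ (⟨ snd , fst ⟩ ∙ snd))
compile (tab f)      =
  fold nil (cons ∙ ⟨ compile f ∙ ⟨ fst ∙ snd , ⟨ snd ∙ snd , fst ∙ fst ⟩ ⟩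
                   , snd ∙ fst ⟩)
  ∙ ⟨ fst , id ⟩
compile (loop z f)   =
  fold (compile z)
       (compile f ∙ ⟨ fst ∙ snd , ⟨ ⟨ snd ∙ snd , fst ∙ fst ⟩ , snd ∙ fst ⟩ ⟩)
  ∙ ⟨ fst , id ⟩

-- Correctness of the compilation.

eval-tailₚ : ∀ {σ} (xs : ⟦ list σ ⟧) → eval tailₚ xs ≡ drop 1 xs
eval-tailₚ []       = refl
eval-tailₚ (x ∷ xs) = refl

tail-drop : ∀ {A : Set} m (xs : List A) → drop 1 (drop m xs) ≡ drop (suc m) xs
tail-drop zero    xs       = refl
tail-drop (suc m) []       = refl
tail-drop (suc m) (x ∷ xs) = tail-drop m xs

eval-dropₚ : ∀ {σ} m (xs : ⟦ list σ ⟧) →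
             eval dropₚ (replicate m true , xs) ≡ drop m xs
eval-dropₚ         zero    xs = refl
eval-dropₚ {σ = σ} (suc m) xs = trans (eval-tailₚ {σ} (eval dropₚ (replicate m true , xs)))
  (trans (cong (drop 1) (eval-dropₚ m xs)) (tail-drop m xs))

drop-replicate : ∀ {A : Set} m p {a : A} →
                 drop m (replicate p a) ≡ replicate (p ∸ m) a
drop-replicate zero    p       = refl
drop-replicate (suc m) zero    = refl
drop-replicate (suc m) (suc p) = drop-replicate m p

eval-at : ∀ {σ n} (f : Fin n → ⟦ σ ⟧) i →
          eval headₚ (drop (toℕ i) (tabulate f)) ≡ f i
eval-at f zero    = refl
eval-at f (suc i) = eval-at (λ j → f (suc j)) i

loop-body : ∀ {Γ τ} → Term ((Γ ⊗ idx) ⊗ τ) τ →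
            Prog ((list bool ⊗ ty τ) ⊗ (list (list bool) ⊗ ty Γ)) (ty τ)
loop-body f =
  compile f ∙ ⟨ fst ∙ snd , ⟨ ⟨ snd ∙ snd , fst ∙ fst ⟩ , snd ∙ fst ⟩ ⟩

correct : ∀ {Γ τ n} (e : Term Γ τ) (γ : Val Γ n) →
          eval (compile e) (indices n , enc Γ γ) ≡ enc τ (sem e γ)
-- The induction passes to tails of the index list while the context keeps all of `indices n`; hence
-- the list is an arbitrary family `g` of indices.
correct-fold : ∀ {Γ τ n m} (z : Term Γ τ) (f : Term ((Γ ⊗ idx) ⊗ τ) τ) (γ : Val Γ n)
               (g : Fin m → Fin n) →
               eval (fold (compile z) (loop-body f))
                    (tabulate (λ i → enc idx (g i)) , (indices n , enc Γ γ))
               ≡ enc τ (foldFin m (λ i x → sem f ((γ , g i) , x)) (sem z γ))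

correct id           γ = refl
correct (f ∙ g)      γ rewrite correct g γ = correct f (sem g γ)
correct ⟨ f , g ⟩    γ = cong₂ _,_ (correct f γ) (correct g γ)
correct fst          γ = refl
correct snd          γ = refl
correct (const b)    γ = refl
correct (cond c f g) γ rewrite correct c γ with sem c γ
... | true  = correct f γ
... | false = correct g γ
correct nil          γ = refl
correct cons         γ = refl
correct zeroₜ        γ = refl
correct sucₜ         γ = refl
correct predₜ zero    = refl
correct predₜ (suc m) = refl
correct isZeroₜ zero    = refl
correct isZeroₜ (suc m) = refl
correct monus (i , j) = trans (eval-dropₚ (toℕ j) (replicate (toℕ i) true))
                              (drop-replicate (toℕ j) (toℕ i))
correct (at {τ}) (f , i)
  rewrite eval-dropₚ {ty τ} (toℕ i) (tabulate (λ j → enc τ (f j)))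
  = eval-at {ty τ} (λ j → enc τ (f j)) i
correct {Γ} {n = n} (tab {τ = τ} f) γ = go (λ i → i)
  where
  go : ∀ {m} (g : Fin m → Fin n) →
       eval (fold nil (cons ∙ ⟨ compile f ∙ ⟨ fst ∙ snd , ⟨ snd ∙ snd , fst ∙ fst ⟩ ⟩
                              , snd ∙ fst ⟩))
            (tabulate (λ i → enc idx (g i)) , (indices n , enc Γ γ))
       ≡ tabulate (λ i → enc τ (sem f (γ , g i)))
  go {zero}  g = refl
  go {suc m} g = cong₂ _∷_ (correct f (γ , g zero)) (go (λ i → g (suc i)))
correct (loop z f)   γ = correct-fold z f γ (λ i → i)

correct-fold {m = zero}  z f γ g = correct z γ
correct-fold {m = suc m} z f γ g
  rewrite correct-fold z f γ (λ i → g (suc i)) = correct f ((γ , g zero) , _)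

-- Polynomial bounds on the cost of compiled terms.

bound : ∀ {Γ τ} → Term Γ τ → ℕ → ℕ
bound (f ∙ g)      n = 3 + (bound f n + bound g n)
bound ⟨ f , g ⟩    n = 1 + (bound f n + bound g n)
bound (cond c f g) n = 4 + (bound c n + (bound f n + bound g n))
bound (tab f)      n = 6 + n * (20 + bound f n)
bound (loop z f)   n = 6 + (bound z n + n * (20 + bound f n))
bound monus        n = 40 + n * 20
bound at           n = 40 + n * 20
bound _            n = 20

cost-tailₚ : ∀ {σ} (xs : ⟦ list σ ⟧) → cost tailₚ xs ≤ 8
cost-tailₚ []       = m≤n⇒m≤o+n 2 ≤-refl
cost-tailₚ (x ∷ xs) = ≤-refl

cost-dropₚ : ∀ {σ} m (xs : ⟦ list σ ⟧) →
             cost dropₚ (replicate m true , xs) ≤ 2 + m * 20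
cost-dropₚ         zero    xs = ≤-refl
cost-dropₚ {σ = σ} (suc m) xs = begin
  suc (cost (dropₚ {σ}) (replicate m true , xs) + suc (3 + cost (tailₚ {σ}) (eval dropₚ (replicate m true , xs))))
    ≤⟨ s≤s (+-mono-≤ (cost-dropₚ m xs) (s≤s (+-monoʳ-≤ 3 (cost-tailₚ {σ} (eval dropₚ (replicate m true , xs)))))) ⟩
  suc (2 + m * 20 + 12)
    ≡⟨ cong suc (+-comm (2 + m * 20) 12) ⟩
  15 + m * 20
    ≤⟨ +-monoˡ-≤ (m * 20) (m≤n⇒m≤o+n 7 ≤-refl) ⟩
  2 + suc m * 20 ∎
  where open ≤-Reasoning

cost-dropₚ-idx : ∀ {σ n} (i : Fin n) (xs : ⟦ list σ ⟧) →
                 cost dropₚ (replicate (toℕ i) true , xs) ≤ 2 + n * 20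
cost-dropₚ-idx i xs = ≤-trans (cost-dropₚ (toℕ i) xs)
  (+-monoʳ-≤ 2 (*-monoˡ-≤ 20 (<⇒≤ (toℕ<n i))))

-- Dropping i < n entries leaves a non-empty list, so the branch with the default value is not
-- taken.
cost-headₚ : ∀ {σ n} (f : Fin n → ⟦ σ ⟧) (i : Fin n) → let xs = drop (toℕ i) (tabulate f) in
             cost (match (default σ) (fst ∙ fst)) (xs , xs) ≡ 4
cost-headₚ f zero    = refl
cost-headₚ f (suc i) = cost-headₚ (λ j → f (suc j)) i

≤20 : ∀ {m} → T (m ≤ᵇ 20) → m ≤ 20
≤20 {m} = ≤ᵇ⇒≤ m 20

tab-step : ∀ m {r b c} → r ≤ 2 + m * (20 + b) → c ≤ b →
           suc (r + suc (suc (suc (11 + c) + 3) + 1)) ≤ 2 + suc m * (20 + b)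
tab-step m {r} {b} {c} p q = begin
  suc (r + suc (suc (suc (11 + c) + 3) + 1))
    ≡⟨ solve 2 (λ r c → con 1 :+ (r :+ (con 1 :+ (con 1 :+ (con 1 :+ (con 11 :+ c) :+ con 3) :+ con 1)))
                     := con 19 :+ c :+ r) refl r c ⟩
  19 + c + r
    ≤⟨ +-mono-≤ (+-mono-≤ (≤ᵇ⇒≤ 19 20 _) q) p ⟩
  20 + b + (2 + m * (20 + b))
    ≡⟨ solve 2 (λ x y → x :+ (con 2 :+ y) := con 2 :+ (x :+ y)) refl (20 + b) (m * (20 + b)) ⟩
  2 + suc m * (20 + b) ∎
  where
  open ≤-Reasoning

loop-step : ∀ m {r z b c} → r ≤ suc z + m * (20 + b) → c ≤ b →
            suc (r + suc (15 + c)) ≤ suc z + suc m * (20 + b)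
loop-step m {r} {z} {b} {c} p q = begin
  suc (r + suc (15 + c))
    ≡⟨ solve 2 (λ r c → con 1 :+ (r :+ (con 16 :+ c)) := con 17 :+ c :+ r) refl r c ⟩
  17 + c + r
    ≤⟨ +-mono-≤ (+-mono-≤ (≤ᵇ⇒≤ 17 20 _) q) p ⟩
  20 + b + (suc z + m * (20 + b))
    ≡⟨ solve 3 (λ x y z → x :+ (con 1 :+ z :+ y) := con 1 :+ z :+ (x :+ y)) refl (20 + b) (m * (20 + b)) z ⟩
  suc z + suc m * (20 + b) ∎
  where
  open ≤-Reasoning

-- The induction hypotheses speak of encoded contexts only. Correctness of the compilation turns
-- intermediate results into encodings, so that they apply. The constants in `bound` are generous.
cost≤bound : ∀ {Γ τ n} (e : Term Γ τ) (γ : Val Γ n) →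
             cost (compile e) (indices n , enc Γ γ) ≤ bound e n
cost≤bound id           γ = ≤20 _
cost≤bound (f ∙ g)      γ rewrite correct g γ =
  s≤s (s≤s (s≤s (+-mono-≤′ (cost≤bound f (sem g γ)) (cost≤bound g γ))))
  where
  +-mono-≤′ : ∀ {a b c d} → a ≤ b → c ≤ d → c + a ≤ b + d
  +-mono-≤′ {a} {b} {c} {d} p q = ≤-trans (+-mono-≤ q p) (≤-reflexive (+-comm d b))
cost≤bound ⟨ f , g ⟩    γ = s≤s (+-mono-≤ (cost≤bound f γ) (cost≤bound g γ))
cost≤bound fst          γ = ≤20 _
cost≤bound snd          γ = ≤20 _
cost≤bound (const b)    γ = ≤20 _
cost≤bound {Γ} {n = n} (cond c f g) γ = s≤s (begin
  suc (cost (compile c) x + 1) + cost (cond (compile f) (compile g)) (eval (compile c) x , x)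
    ≤⟨ +-mono-≤ (s≤s (+-monoˡ-≤ 1 (cost≤bound c γ))) branches ⟩
  suc (bound c n + 1) + suc (bound f n + bound g n)
    ≡⟨ solve 3 (λ a b d → con 1 :+ (a :+ con 1) :+ (con 1 :+ (b :+ d))
                       := con 3 :+ (a :+ (b :+ d))) refl (bound c n) (bound f n) (bound g n) ⟩
  3 + (bound c n + (bound f n + bound g n)) ∎)
  where
  open ≤-Reasoning
  x = indices n , enc Γ γ
  branches : cost (cond (compile f) (compile g)) (eval (compile c) x , x)
             ≤ suc (bound f n + bound g n)
  branches with eval (compile c) x
  ... | true  = s≤s (≤-trans (cost≤bound f γ) (m≤m+n _ _))
  ... | false = s≤s (≤-trans (cost≤bound g γ) (m≤n+m _ _))
cost≤bound nil          γ = ≤20 _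
cost≤bound cons         γ = ≤20 _
cost≤bound zeroₜ        γ = ≤20 _
cost≤bound sucₜ         γ = ≤20 _
cost≤bound predₜ zero    = ≤20 _
cost≤bound predₜ (suc m) = ≤20 _
cost≤bound isZeroₜ zero    = ≤20 _
cost≤bound isZeroₜ (suc m) = ≤20 _
cost≤bound {n = n} monus (i , j) = ≤-trans
  (+-monoʳ-≤ 6 (cost-dropₚ-idx j (replicate (toℕ i) true)))
  (+-monoˡ-≤ (n * 20) {8} {40} (≤ᵇ⇒≤ 8 40 _))
cost≤bound {n = n} (at {τ}) (f , i)
  = begin
  suc (suc (5 + c) + suc (3 + h ys))
    ≡⟨ cong (λ x → suc (suc (5 + c) + suc (3 + x))) ys-cost ⟩
  7 + c + 8 ≡⟨ +-comm (7 + c) 8 ⟩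
  15 + c ≤⟨ +-monoʳ-≤ 15 (cost-dropₚ-idx i xs) ⟩
  17 + n * 20 ≤⟨ +-monoˡ-≤ (n * 20) {17} {40} (≤ᵇ⇒≤ 17 40 _) ⟩
  40 + n * 20 ∎
  where
  open ≤-Reasoning
  h : List ⟦ ty τ ⟧ → ℕ
  h ys = cost (match (default (ty τ)) (fst ∙ fst)) (ys , ys)
  xs ys : List ⟦ ty τ ⟧
  xs = tabulate (λ j → enc τ (f j))
  ys = eval dropₚ (replicate (toℕ i) true , xs)
  c = cost (dropₚ {ty τ}) (replicate (toℕ i) true , xs)
  ys-cost : h ys ≡ 4
  ys-cost = trans (cong h (eval-dropₚ (toℕ i) xs))
                  (cost-headₚ {ty τ} (λ j → enc τ (f j)) i)
cost≤bound {Γ} {n = n} (tab {τ = τ} f) γ = s≤s (s≤s (s≤s (s≤s (go (λ i → i)))))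
  where
  go : ∀ {m} (g : Fin m → Fin n) →
       cost (fold nil (cons ∙ ⟨ compile f ∙ ⟨ fst ∙ snd , ⟨ snd ∙ snd , fst ∙ fst ⟩ ⟩
                              , snd ∙ fst ⟩))
            (tabulate (λ i → enc idx (g i)) , (indices n , enc Γ γ))
       ≤ 2 + m * (20 + bound f n)
  go {zero}  g = ≤-refl
  go {suc m} g = tab-step m (go (λ i → g (suc i))) (cost≤bound f (γ , g zero))
cost≤bound {Γ} {n = n} (loop {τ = τ} z f) γ =
  s≤s (s≤s (s≤s (s≤s (≤-trans (go (λ i → i)) (n≤1+n _)))))
  where
  go : ∀ {m} (g : Fin m → Fin n) →
       cost (fold (compile z) (loop-body f))
            (tabulate (λ i → enc idx (g i)) , (indices n , enc Γ γ))
       ≤ suc (bound z n) + m * (20 + bound f n)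
  go {zero}  g = ≤-trans (s≤s (cost≤bound z γ)) (m≤m+n _ 0)
  go {suc m} g rewrite correct-fold z f γ (λ i → g (suc i)) =
    loop-step m (go (λ i → g (suc i))) (cost≤bound f ((γ , g zero) , _))

-- One constant is both coefficient and exponent, as in `Constructs`. For n ≥ 1 the power grows with
-- the exponent, which allows two bounds to be merged.
IsPoly : (ℕ → ℕ) → Set
IsPoly f = ∃[ c ] (∀ n → .{{NonZero n}} → f n ≤ c * n ^ c)

poly-const : ∀ k → IsPoly (λ _ → k)
poly-const k = k , λ n → m≤m*n k (n ^ k) {{m^n≢0 n k}}

poly-id : IsPoly (λ n → n)
poly-id = 1 , λ n → ≤-reflexive (sym (trans (*-identityˡ (n * 1)) (*-identityʳ n)))

poly-+ : ∀ {f g} → IsPoly f → IsPoly g → IsPoly (λ n → f n + g n)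
poly-+ (c , p) (d , q) = c + d , λ n → ≤-trans (+-mono-≤ (p n) (q n))
  (≤-trans (+-mono-≤ (*-monoʳ-≤ c (^-monoʳ-≤ n (m≤m+n c d)))
                     (*-monoʳ-≤ d (^-monoʳ-≤ n (m≤n+m d c))))
           (≤-reflexive (sym (*-distribʳ-+ (n ^ (c + d)) c d))))

poly-* : ∀ {f g} → IsPoly f → IsPoly g → IsPoly (λ n → f n * g n)
-- The constant has to be at least cd as a coefficient and at least c + d as an exponent; the sum is
-- both.
poly-* {f} {g} (c , p) (d , q) = c * d + (c + d) , λ n → begin
  f n * g n                       ≤⟨ *-mono-≤ (p n) (q n) ⟩
  c * n ^ c * (d * n ^ d)         ≡⟨ solve 4 (λ a b x y → a :* x :* (b :* y) := a :* b :* (x :* y)) refl c d (n ^ c) (n ^ d) ⟩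
  c * d * (n ^ c * n ^ d)         ≡⟨ cong (c * d *_) (sym (^-distribˡ-+-* n c d)) ⟩
  c * d * n ^ (c + d)             ≤⟨ *-mono-≤ (m≤m+n (c * d) (c + d)) (^-monoʳ-≤ n (m≤n+m (c + d) (c * d))) ⟩
  (c * d + (c + d)) * n ^ (c * d + (c + d)) ∎
  where
  open ≤-Reasoning

bound-poly : ∀ {Γ τ} (e : Term Γ τ) → IsPoly (bound e)
bound-poly id           = poly-const 20
bound-poly (f ∙ g)      = poly-+ (poly-const 3) (poly-+ (bound-poly f) (bound-poly g))
bound-poly ⟨ f , g ⟩    = poly-+ (poly-const 1) (poly-+ (bound-poly f) (bound-poly g))
bound-poly fst          = poly-const 20
bound-poly snd          = poly-const 20
bound-poly (const b)    = poly-const 20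
bound-poly (cond c f g) =
  poly-+ (poly-const 4) (poly-+ (bound-poly c) (poly-+ (bound-poly f) (bound-poly g)))
bound-poly nil          = poly-const 20
bound-poly cons         = poly-const 20
bound-poly zeroₜ        = poly-const 20
bound-poly sucₜ         = poly-const 20
bound-poly predₜ        = poly-const 20
bound-poly isZeroₜ      = poly-const 20
bound-poly monus        = poly-+ (poly-const 40) (poly-* poly-id (poly-const 20))
bound-poly at           = poly-+ (poly-const 40) (poly-* poly-id (poly-const 20))
bound-poly (tab f)      =
  poly-+ (poly-const 6) (poly-* poly-id (poly-+ (poly-const 20) (bound-poly f)))
bound-poly (loop z f)   =
  poly-+ (poly-const 6) (poly-+ (bound-poly z)
    (poly-* poly-id (poly-+ (poly-const 20) (bound-poly f))))

-- Generating the list of indices from the input.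

mapSucₚ : Prog (list (list bool)) (list (list bool))
mapSucₚ =
  fold nil (cons ∙ ⟨ cons ∙ ⟨ const true , fst ∙ fst ⟩ , snd ∙ fst ⟩) ∙ ⟨ id , id ⟩

-- Each row of the input puts 0 in front of the successors of the indices obtained so far. So n rows
-- yield the unary numbers below n, in quadratic time.
indices-fold : ∀ {ρ σ} → Prog (list σ ⊗ ρ) (list (list bool))
indices-fold = fold nil (cons ∙ ⟨ nil , mapSucₚ ∙ (snd ∙ fst) ⟩)

indicesₚ : ∀ {σ} → Prog (list σ) (list (list bool))
indicesₚ = indices-fold ∙ ⟨ id , id ⟩

eval-mapSucₚ : ∀ {n} (g : Fin n → List Bool) →
               eval mapSucₚ (tabulate g) ≡ tabulate (λ i → true ∷ g i)
eval-mapSucₚ g = go g _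
  where
  go : ∀ {m} (g : Fin m → List Bool) (p : List (List Bool)) →
       eval (fold nil (cons ∙ ⟨ cons ∙ ⟨ const true , fst ∙ fst ⟩ , snd ∙ fst ⟩)) (tabulate g , p)
       ≡ tabulate (λ i → true ∷ g i)
  go {zero}  g p = refl
  go {suc m} g p = cong ((true ∷ g zero) ∷_) (go (λ i → g (suc i)) p)

cost-mapSucₚ : ∀ xs → cost mapSucₚ xs ≡ 6 + length xs * 14
cost-mapSucₚ xs = cong (4 +_) (go xs xs)
  where
  go : ∀ xs p → cost (fold nil (cons ∙ ⟨ cons ∙ ⟨ const true , fst ∙ fst ⟩ , snd ∙ fst ⟩)) (xs , p)
                ≡ 2 + length xs * 14
  go []       p = refl
  go (x ∷ xs) p = trans (cong (λ r → suc (r + 13)) (go xs p)) (cong suc (+-comm _ 13))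

eval-indices-fold : ∀ {ρ σ n} (g : Fin n → ⟦ σ ⟧) (p : ⟦ ρ ⟧) →
                    eval (indices-fold {ρ} {σ}) (tabulate g , p) ≡ indices n
eval-indices-fold {n = zero} g p = refl
eval-indices-fold {ρ} {σ} {suc n} g p = cong ([] ∷_)
  (trans (cong (eval mapSucₚ) (eval-indices-fold {ρ} {σ} (λ i → g (suc i)) p))
         (eval-mapSucₚ {n} (enc idx)))

cost-indicesₚ : ∀ {σ n} (g : Fin n → ⟦ σ ⟧) →
                cost (indicesₚ {σ}) (tabulate g) ≤ 6 + n * (15 + n * 14)
cost-indicesₚ {σ} {n} g = s≤s (s≤s (s≤s (s≤s (go ≤-refl g (tabulate g)))))
  where
  open ≤-Reasoning
  go : ∀ {m} → m ≤ n → (g : Fin m → ⟦ σ ⟧) → ∀ p →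
       cost (indices-fold {list σ} {σ}) (tabulate g , p) ≤ 2 + m * (15 + n * 14)
  go {zero}  _ g p = ≤-refl
  go {suc m} m<n g p = begin
    suc (r + suc (suc (1 + suc (3 + cost mapSucₚ is)) + 1))
      ≡⟨ cong (λ x → suc (r + suc (suc (1 + suc (3 + x)) + 1))) is-cost ⟩
    suc (r + suc (suc (1 + suc (3 + (6 + m * 14))) + 1))
      ≡⟨ solve 2 (λ r x → con 1 :+ (r :+ (con 1 :+ (con 12 :+ x :+ con 1)))
                       := con 15 :+ x :+ r) refl r (m * 14) ⟩
    15 + m * 14 + r
      ≤⟨ +-mono-≤ (+-monoʳ-≤ 15 (*-monoˡ-≤ 14 (<⇒≤ m<n))) (go (<⇒≤ m<n) (λ i → g (suc i)) p) ⟩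
    15 + n * 14 + (2 + m * (15 + n * 14))
      ≡⟨ solve 2 (λ x y → x :+ (con 2 :+ y) := con 2 :+ (x :+ y)) refl (15 + n * 14) (m * (15 + n * 14)) ⟩
    2 + suc m * (15 + n * 14) ∎
    where
    r = cost (indices-fold {list σ} {σ}) (tabulate (λ i → g (suc i)) , p)
    is = eval (indices-fold {list σ} {σ}) (tabulate (λ i → g (suc i)) , p)
    is-cost : cost mapSucₚ is ≡ 6 + m * 14
    is-cost = trans (cost-mapSucₚ is) (cong (λ x → 6 + x * 14)
      (trans (cong length (eval-indices-fold {list σ} {σ} (λ i → g (suc i)) p))
             (length-tabulate {n = m} (enc idx))))

program : ∀ {σ τ} → Term (vec σ) τ → Prog (list (ty σ)) (ty τ)
program e = compile e ∙ ⟨ indicesₚ , id ⟩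

eval-program : ∀ {σ τ n} (e : Term (vec σ) τ) (f : Val (vec σ) n) →
               eval (program e) (enc (vec σ) f) ≡ enc τ (sem e f)
eval-program {σ} e f
  rewrite eval-indices-fold {list (ty σ)} {ty σ} (λ i → enc σ (f i)) (enc (vec σ) f) = correct e f

cost-program : ∀ {σ τ} (e : Term (vec σ) τ) →
               ∃[ c ] (∀ n → .{{NonZero n}} → (f : Val (vec σ) n) →
                       cost (program e) (enc (vec σ) f) ≤ c * n ^ c)
cost-program {σ} e = proj₁ poly , λ n f → ≤-trans (bounded n f) (proj₂ poly n)
  where
  open ≤-Reasoning
  poly : IsPoly (λ n → 3 + (6 + n * (15 + n * 14)) + bound e n)
  poly = poly-+ (poly-+ (poly-const 3) (poly-+ (poly-const 6)
           (poly-* poly-id (poly-+ (poly-const 15) (poly-* poly-id (poly-const 14))))))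
           (bound-poly e)
  bounded : ∀ n (f : Val (vec σ) n) →
            cost (program e) (enc (vec σ) f) ≤ 3 + (6 + n * (15 + n * 14)) + bound e n
  bounded n f
    rewrite eval-indices-fold {list (ty σ)} {ty σ} (λ i → enc σ (f i)) (enc (vec σ) f) = begin
    suc (suc (c + 1) + cost (compile e) (indices n , enc (vec σ) f))
      ≡⟨ cong (λ x → suc (suc x + cost (compile e) (indices n , enc (vec σ) f))) (+-comm c 1) ⟩
    3 + c + cost (compile e) (indices n , enc (vec σ) f)
      ≤⟨ +-mono-≤ (+-monoʳ-≤ 3 (cost-indicesₚ {ty σ} (λ i → enc σ (f i)))) (cost≤bound e f) ⟩
    3 + (6 + n * (15 + n * 14)) + bound e n ∎
    where c = cost (indicesₚ {ty σ}) (enc (vec σ) f)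

compile-polynomial : ∀ {σ τ} (e : Term (vec σ) τ) →
  Σ[ P ∈ Prog (list (ty σ)) (ty τ) ] ∃[ c ]
    (∀ n → .{{NonZero n}} → (f : Val (vec σ) n) →
     eval P (enc (vec σ) f) ≡ enc τ (sem e f) × cost P (enc (vec σ) f) ≤ c * n ^ c)
compile-polynomial e = program e , proj₁ (cost-program e) ,
  λ n f → eval-program e f , proj₂ (cost-program e) n f

-- The algorithm

infixr 6 _and_ _andₜ_
infixr 5 _or_ _orₜ_

-- Written with `if`, like the meaning of `cond`, so that the functions below agree definitionally
-- with the terms that implement them.
_and_ _or_ : Bool → Bool → Bool
a and b = if a then b else false
a or b  = if a then true else b

neg : Bool → Bool
neg a = if a then false else true

VSet Rel : ℕ → Set
VSet n = Fin n → Bool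
Rel n  = Fin n → Fin n → Bool

-- Two truncated differences, because `monus` is the only comparison of indices that terms offer.
same : ∀ {n} → Rel n
same i j = isZero (toℕ i ∸ toℕ j) and isZero (toℕ j ∸ toℕ i)

anyFin : ∀ {n} → VSet n → Bool
anyFin p = foldFin _ (λ i b → p i or b) false

count : ∀ {n} → VSet n → ℕ
count p = foldFin _ (λ i c → if p i then suc c else c) 0

first : ∀ {n} → VSet n → Fin n → Fin n
first p d = foldFin _ (λ i j → if p i then i else j) d

expand : ∀ {n} → Rel n → Rel n → Rel n
expand R D u v = D u v or anyFin (λ w → D u w and R w v)

-- Reachability: n rounds suffice since a path has fewer than n edges.
closure : ∀ {n} → Rel n → Rel n
closure {n} R = foldFin n (λ _ D → expand R D) same

restrict : ∀ {n} → Rel n → VSet n → Rel n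
restrict R A u v = R u v and (A u and A v)

-- Decrementing is truncated, so that the counter starts at one more than the
-- size of q and remains positive iff p has at most half the size of q.
halfOf : ∀ {n} → VSet n → VSet n → Bool
halfOf p q =
  neg (isZero (foldFin _ (λ i c → if p i then pred (pred c) else c) (suc (count q))))

_∖_ : ∀ {n} → VSet n → VSet n → VSet n
(C ∖ X) v = C v and neg (X v)

-- The balanced-separator condition: each component of C minus X has at most half the vertices of C.
balanced : ∀ {n} → Rel n → VSet n → VSet n → Bool
balanced R C X =
  neg (anyFin λ u → (C ∖ X) u and neg (halfOf (closure (restrict R (C ∖ X)) u) C))

-- A vertex keeps the parent it got when it was first reached; roots and unreached vertices are
-- their own parents.
bfs-step : ∀ {n} → Rel n → VSet n × (Fin n → Fin n) → VSet n × (Fin n → Fin n)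
bfs-step R (X , par) =
  (λ u → X u or anyFin (λ w → X w and R w u)) ,
  (λ u → if X u then par u else first (λ w → X w and R w u) u)

bfs : ∀ {n} → Rel n → VSet n → Fin n → Fin n
bfs {n} R X = proj₂ (foldFin n (λ _ s → bfs-step R s) (X , λ u → u))

parent-edges : ∀ {n} → (Fin n → Fin n) → Rel n
parent-edges par u v = neg (same u v) and (same (par u) v or same (par v) u)

add-edge : ∀ {n} → Rel n → Fin n → Fin n → Rel n
add-edge M a b u v = M u v or ((same u a and same v b) or (same u b and same v a))

span-step : ∀ {n} → Rel n → Fin n → Fin n → Rel n → Rel n
span-step R a b M = if R a b and neg (closure M a b) then add-edge M a b else M

-- Kruskal's algorithm without weights, started from the forest F.
span : ∀ {n} → Rel n → Rel n → Rel n
span {n} R F = foldFin n (λ a M → foldFin n (λ b M → span-step R a b M) M) F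

-- Here `c` sends a vertex to the centre chosen for its component. Its fixed points are the centres
-- that lie in the component they serve, and these are the roots.
tree : ∀ {n} → Rel n → VSet n → (Fin n → Fin n) → Rel n
tree R A c =
  span R (parent-edges (bfs (restrict R A) (λ u → same (c u) u)))

-- The algorithm as a term.

x₀ : ∀ {Γ σ} → Term (Γ ⊗ σ) σ
x₀ = snd

x₁ : ∀ {Γ σ τ} → Term ((Γ ⊗ σ) ⊗ τ) σ
x₁ = snd ∙ fst

x₂ : ∀ {Γ ρ σ τ} → Term (((Γ ⊗ ρ) ⊗ σ) ⊗ τ) ρ
x₂ = snd ∙ (fst ∙ fst)

↑² : ∀ {Γ σ τ} → Term ((Γ ⊗ σ) ⊗ τ) Γ
↑² = fst ∙ fst

↑³ : ∀ {Γ ρ σ τ} → Term (((Γ ⊗ ρ) ⊗ σ) ⊗ τ) Γ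
↑³ = fst ∙ (fst ∙ fst)

infixl 9 _!_
_!_ : ∀ {Γ τ} → Term Γ (vec τ) → Term Γ idx → Term Γ τ
f ! i = at ∙ ⟨ f , i ⟩

_andₜ_ _orₜ_ : ∀ {Γ} → Term Γ bool → Term Γ bool → Term Γ bool
a andₜ b = cond a b (const false)
a orₜ b  = cond a (const true) b

negₜ : ∀ {Γ} → Term Γ bool → Term Γ bool
negₜ a = cond a (const false) (const true)

sameₜ : ∀ {Γ} → Term Γ idx → Term Γ idx → Term Γ bool
sameₜ i j = (isZeroₜ ∙ (monus ∙ ⟨ i , j ⟩)) andₜ (isZeroₜ ∙ (monus ∙ ⟨ j , i ⟩))

anyₜ : ∀ {Γ} → Term (Γ ⊗ idx) bool → Term Γ bool
anyₜ p = loop (const false) ((p ∙ fst) orₜ x₀)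

firstₜ : ∀ {Γ} → Term (Γ ⊗ idx) bool → Term Γ idx → Term Γ idx
firstₜ p d = loop d (cond (p ∙ fst) x₁ x₀)

set mat : Type
set = vec bool
mat = vec set

expandₜ : Term (mat ⊗ mat) mat
expandₜ = tab (tab ((x₂ ! x₁ ! x₀) orₜ anyₜ (((snd ∙ ↑³) ! x₂ ! x₀) andₜ ((fst ∙ ↑³) ! x₀ ! x₁))))

closureₜ : Term mat mat
closureₜ = loop (tab (tab (sameₜ x₁ x₀))) (expandₜ ∙ ⟨ ↑² , x₀ ⟩)

restrictₜ : Term (mat ⊗ set) mat
restrictₜ = tab (tab (((fst ∙ ↑²) ! x₁ ! x₀) andₜ ((x₂ ! x₁) andₜ (x₂ ! x₀))))

halfOfₜ : Term (set ⊗ set) bool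
halfOfₜ = negₜ (isZeroₜ ∙ loop
  (sucₜ ∙ loop zeroₜ (cond ((snd ∙ ↑²) ! x₁) (sucₜ ∙ x₀) x₀))
  (cond ((fst ∙ ↑²) ! x₁) (predₜ ∙ (predₜ ∙ x₀)) x₀))

differenceₜ : Term (set ⊗ set) set
differenceₜ = tab (((fst ∙ fst) ! x₀) andₜ negₜ (x₁ ! x₀))

balancedₜ : Term ((mat ⊗ set) ⊗ set) bool
balancedₜ = negₜ (anyₜ ((Y ! x₀) andₜ negₜ (halfOfₜ ∙ ⟨ (closureₜ ∙ (restrictₜ ∙ ⟨ R , Y ⟩)) ! x₀ , C ⟩)))
  where
  R : Term (((mat ⊗ set) ⊗ set) ⊗ idx) mat
  R = fst ∙ ↑²
  C Y : Term (((mat ⊗ set) ⊗ set) ⊗ idx) set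
  C = x₂
  Y = differenceₜ ∙ ⟨ x₂ , x₁ ⟩

tuple : ℕ → Type
tuple zero    = bool
tuple (suc k) = idx ⊗ tuple k

constant-tuple : ∀ {Γ} k → Term Γ idx → Term Γ (tuple k)
constant-tuple zero    i = const true
constant-tuple (suc k) i = ⟨ i , constant-tuple k i ⟩

-- The last three components of the context are the relation whose rows are the
-- disks, the union of the disks chosen so far, and an arbitrary index.
searchₜ : ∀ k → Term ((((mat ⊗ set) ⊗ mat) ⊗ set) ⊗ idx) (bool ⊗ (set ⊗ tuple k))
searchₜ zero    = ⟨ balancedₜ ∙ ⟨ fst ∙ ↑² , x₁ ⟩ , ⟨ x₁ , const true ⟩ ⟩
searchₜ (suc k) = loop
  ⟨ const false , ⟨ x₁ , constant-tuple (suc k) x₀ ⟩ ⟩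
  (cond (fst ∙ r) ⟨ const true , ⟨ fst ∙ (snd ∙ r) , ⟨ x₁ , snd ∙ (snd ∙ r) ⟩ ⟩ ⟩ x₀)
  where
  Δ : Type
  Δ = ((((((mat ⊗ set) ⊗ mat) ⊗ set) ⊗ idx) ⊗ idx) ⊗ (bool ⊗ (set ⊗ tuple (suc k))))
  r : Term Δ (bool ⊗ (set ⊗ tuple k))
  r = searchₜ k ∙ ⟨ ⟨ ↑² ∙ ↑² , tab (((x₁ ∙ ↑³) ! x₀) orₜ ((x₂ ∙ ↑³) ! x₂ ! x₀)) ⟩ , snd ∙ ↑² ⟩

-- The loop carries the disks of the current radius, starting from radius 0, and the first success.
-- So the least radius that works is found without knowledge of t. Distances are those of the whole
-- graph, not of the component.
chooseₜ : ∀ k → Term ((mat ⊗ set) ⊗ idx) (bool ⊗ (set ⊗ tuple k))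
chooseₜ k = snd ∙ loop
  ⟨ tab (tab (sameₜ x₁ x₀)) , ⟨ const false , ⟨ tab (const false) , constant-tuple k x₀ ⟩ ⟩ ⟩
  ⟨ expandₜ ∙ ⟨ fst ∙ (fst ∙ ↑²) , fst ∙ x₀ ⟩
  , cond (fst ∙ (snd ∙ x₀)) (snd ∙ x₀)
      (searchₜ k ∙ ⟨ ⟨ ⟨ fst ∙ ↑² , fst ∙ x₀ ⟩ , tab (const false) ⟩ , snd ∙ ↑² ⟩) ⟩

-- Every vertex solves the problem for its own component. Starting from the first vertex of the
-- component gives all its vertices the same separator and the same centres.
solutionₜ : ∀ k → Term ((mat ⊗ set) ⊗ idx) (bool ⊗ (set ⊗ tuple k))
solutionₜ k = chooseₜ k ∙ ⟨ ⟨ fst ∙ fst , K ! rep ⟩ , rep ⟩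
  where
  K : Term ((mat ⊗ set) ⊗ idx) mat
  K = closureₜ ∙ (restrictₜ ∙ fst)
  rep : Term ((mat ⊗ set) ⊗ idx) idx
  rep = firstₜ ((K ∙ fst) ! x₁ ! x₀) x₀

nextₜ : ∀ k → Term (mat ⊗ set) set
nextₜ k = tab ((x₁ ! x₀) andₜ negₜ ((fst ∙ (snd ∙ solutionₜ k)) ! x₀))

bfsₜ : Term (mat ⊗ set) (vec idx)
bfsₜ = snd ∙ loop ⟨ snd , tab x₀ ⟩
  ⟨ tab (((fst ∙ x₁) ! x₀) orₜ anyₜ (((fst ∙ x₂) ! x₀) andₜ ((fst ∙ (↑² ∙ ↑²)) ! x₀ ! x₁)))
  , tab (cond ((fst ∙ x₁) ! x₀) ((snd ∙ x₁) ! x₀)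
      (firstₜ (((fst ∙ x₂) ! x₀) andₜ ((fst ∙ (↑² ∙ ↑²)) ! x₀ ! x₁)) x₀)) ⟩

parent-edgesₜ : Term (vec idx) mat
parent-edgesₜ =
  tab (tab (negₜ (sameₜ x₁ x₀) andₜ (sameₜ (↑² ! x₁) x₀ orₜ sameₜ (↑² ! x₀) x₁)))

add-edgeₜ : Term ((mat ⊗ idx) ⊗ idx) mat
add-edgeₜ = tab (tab (((fst ∙ (fst ∙ ↑²)) ! x₁ ! x₀) orₜ
  ((sameₜ x₁ (snd ∙ (fst ∙ ↑²)) andₜ sameₜ x₀ x₂) orₜ
   (sameₜ x₁ x₂ andₜ sameₜ x₀ (snd ∙ (fst ∙ ↑²))))))

spanₜ : Term (mat ⊗ mat) mat
spanₜ = loop snd (loop x₀ (cond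
  (((fst ∙ (↑² ∙ ↑²)) ! (x₁ ∙ ↑²) ! x₁) andₜ negₜ ((closureₜ ∙ x₀) ! (x₁ ∙ ↑²) ! x₁))
  (add-edgeₜ ∙ ⟨ ⟨ x₀ , x₁ ∙ ↑² ⟩ , x₁ ⟩)
  x₀))

treeₜ : Term ((mat ⊗ set) ⊗ vec idx) mat
treeₜ = spanₜ ∙ ⟨ fst ∙ fst
  , parent-edgesₜ ∙ (bfsₜ ∙ ⟨ restrictₜ ∙ fst , tab (sameₜ (x₁ ! x₀) x₀) ⟩) ⟩

treesₜ : ∀ k → Term (((mat ⊗ set) ⊗ vec (tuple k)) ⊗ list mat) (list mat)
treesₜ zero    = snd
treesₜ (suc k) = cons ∙ ⟨ treeₜ ∙ ⟨ ↑² , tab (fst ∙ (x₂ ! x₀)) ⟩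
  , treesₜ k ∙ ⟨ ⟨ ↑² , tab (snd ∙ (x₂ ! x₀)) ⟩ , snd ⟩ ⟩

-- Once the active set is empty no trees are added, so surplus rounds do no harm.
stepₜ : ∀ k → Term (mat ⊗ (set ⊗ list mat)) (set ⊗ list mat)
stepₜ k = cond (anyₜ ((fst ∙ x₁) ! x₀))
  ⟨ nextₜ k ∙ RA , treesₜ k ∙ ⟨ ⟨ RA , tab (snd ∙ (snd ∙ (solutionₜ k ∙ ⟨ RA ∙ fst , x₀ ⟩))) ⟩ , snd ∙ snd ⟩ ⟩
  snd
  where
  RA : Term (mat ⊗ (set ⊗ list mat)) (mat ⊗ set)
  RA = ⟨ fst , fst ∙ snd ⟩

mainₜ : ∀ k → Term mat (list mat)
mainₜ k = snd ∙ loop ⟨ tab (const true) , nil ⟩ (stepₜ k ∙ ⟨ ↑² , x₀ ⟩)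

-- The meaning of the terms.

Outcome : ℕ → ℕ → Set
Outcome k n = Bool × (VSet n × Val (tuple k) n)

∅ : ∀ {n} → VSet n
∅ _ = false

search : ∀ k {n} → Rel n → VSet n → Rel n → VSet n → Fin n → Outcome k n
search k R C D X d = sem (searchₜ k) ((((R , C) , D) , X) , d)

choose : ∀ k {n} → Rel n → VSet n → Fin n → Outcome k n
choose k R C d = sem (chooseₜ k) ((R , C) , d)

choose-step : ∀ k {n} → Rel n → VSet n → Fin n → Rel n × Outcome k n → Rel n × Outcome k n
choose-step k R C d (D , res) =
  expand R D , (if proj₁ res then res else search k R C D ∅ d)

representative : ∀ {n} → Rel n → VSet n → Fin n → Fin n
representative R A u = first (closure (restrict R A) u) u

solution : ∀ k {n} → Rel n → VSet n → Fin n → Outcome k n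
solution k R A u = choose k R (closure (restrict R A) w) w
  where w = representative R A u

next : ∀ k {n} → Rel n → VSet n → VSet n
next k R A u = A u and neg (proj₁ (proj₂ (solution k R A u)) u)

trees : ∀ k {n} → Rel n → VSet n → (Fin n → Val (tuple k) n) → List (Rel n) → List (Rel n)
trees k R A c ts = sem (treesₜ k) (((R , A) , c) , ts)

advance : ∀ k {n} → Rel n → VSet n × List (Rel n) → VSet n × List (Rel n)
advance k R (A , ts) = if anyFin A
  then (next k R A , trees k R A (λ u → proj₂ (proj₂ (solution k R A u))) ts)
  else (A , ts)

main : ∀ k {n} → Rel n → List (Rel n)
main k {n} R = proj₂ (foldFin n (λ _ s → advance k R s) ((λ _ → true) , []))

-- Walks, balls and distances

and⁺ : ∀ {a b} → T a → T b → T (a and b)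
and⁺ {true} _ q = q

and⁻ : ∀ {a b} → T (a and b) → T a × T b
and⁻ {true} q = tt , q

or⁺ˡ : ∀ {a b} → T a → T (a or b)
or⁺ˡ {true} _ = tt

or⁺ʳ : ∀ {a b} → T b → T (a or b)
or⁺ʳ {true}  _ = tt
or⁺ʳ {false} q = q

or⁻ : ∀ {a b} → T (a or b) → T a ⊎ T b
or⁻ {true}  _ = inj₁ tt
or⁻ {false} q = inj₂ q

neg⁺ : ∀ {a} → ¬ T a → T (neg a)
neg⁺ {true}  f = f tt
neg⁺ {false} _ = tt

neg⁻ : ∀ {a} → T (neg a) → ¬ T a
neg⁻ {false} _ ()

isZero-refl : ∀ m → T (isZero (m ∸ m))
isZero-refl m rewrite n∸n≡0 m = tt

isZero⁻ : ∀ {m} → T (isZero m) → m ≡ 0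
isZero⁻ {zero} _ = refl

same⁺ : ∀ {n} {i j : Fin n} → i ≡ j → T (same i j)
same⁺ {i = i} refl = and⁺ (isZero-refl (toℕ i)) (isZero-refl (toℕ i))

same⁻ : ∀ {n} {i j : Fin n} → T (same i j) → i ≡ j
same⁻ {i = i} {j} p with and⁻ {isZero (toℕ i ∸ toℕ j)} p
... | q , r = toℕ-injective (≤-antisym (m∸n≡0⇒m≤n (isZero⁻ q)) (m∸n≡0⇒m≤n (isZero⁻ r)))

anyFin⁺ : ∀ {n} {p : VSet n} i → T (p i) → T (anyFin p)
anyFin⁺ {p = p} zero    q = or⁺ˡ q
anyFin⁺ {p = p} (suc i) q = or⁺ʳ {p zero} (anyFin⁺ i q)

anyFin⁻ : ∀ {n} {p : VSet n} → T (anyFin p) → ∃[ i ] T (p i)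
anyFin⁻ {suc n} {p} q with or⁻ {p zero} q
... | inj₁ r = zero , r
... | inj₂ r with anyFin⁻ r
...   | i , s = suc i , s

module _ {A : Set} where

  -- The common form of `first` and of the loop in `searchₜ`.
  select : ∀ {m} → (Fin m → Bool) → (Fin m → A) → A → A
  select p g d = foldFin _ (λ i x → if p i then g i else x) d

  select-spec : ∀ (P : A → Set) {m} (p : Fin m → Bool) (g : Fin m → A) d →
                (∀ i → T (p i) → P (g i)) → (∃[ i ] T (p i)) → P (select p g d)
  select-spec P {suc m} p g d h (i , q) with p zero in eq
  ... | true = h zero (subst T (sym eq) tt)
  select-spec P {suc m} p g d h (zero  , q) | false = ⊥-elim (subst T eq q)
  select-spec P {suc m} p g d h (suc i , q) | false =
    select-spec P (λ i → p (suc i)) (λ i → g (suc i)) d (λ i → h (suc i)) (i , q)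

  select-cong : ∀ {m} (p q : Fin m → Bool) (g : Fin m → A) d e →
                (∀ i → p i ≡ q i) → (∃[ i ] T (p i)) → select p g d ≡ select q g e
  select-cong {suc m} p q g d e h (i , r) with p zero in eq | q zero | h zero
  ... | true | .true | refl = refl
  select-cong {suc m} p q g d e h (zero  , r) | false | .false | refl = ⊥-elim (subst T eq r)
  select-cong {suc m} p q g d e h (suc i , r) | false | .false | refl =
    select-cong (λ i → p (suc i)) (λ i → q (suc i)) (λ i → g (suc i)) d e (λ i → h (suc i)) (i , r)

first-spec : ∀ {n} (p : VSet n) d i → T (p i) → T (p (first p d))
first-spec p d i q = select-spec (λ j → T (p j)) p (λ j → j) d (λ _ r → r) (i , q)

first-cong : ∀ {n} (p q : VSet n) d e i → T (p i) → (∀ j → p j ≡ q j) → first p d ≡ first q e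
first-cong p q d e i r h = select-cong p q (λ j → j) d e h (i , r)

T-ext : ∀ {a b} → (T a → T b) → (T b → T a) → a ≡ b
T-ext {true}  {true}  f g = refl
T-ext {true}  {false} f g = ⊥-elim (f tt)
T-ext {false} {true}  f g = ⊥-elim (g tt)
T-ext {false} {false} f g = refl

count-mono : ∀ {n} {p q : VSet n} → (∀ i → T (p i) → T (q i)) → count p ≤ count q
count-mono {zero}          h = z≤n
count-mono {suc n} {p} {q} h with p zero | q zero | h zero
... | true  | true  | _ = s≤s (count-mono (λ i → h (suc i)))
... | true  | false | f = ⊥-elim (f tt)
... | false | true  | _ = m≤n⇒m≤1+n (count-mono (λ i → h (suc i)))
... | false | false | _ = count-mono (λ i → h (suc i))

count≤n : ∀ {n} (p : VSet n) → count p ≤ n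
count≤n {zero}  p = z≤n
count≤n {suc n} p with p zero
... | true  = s≤s (count≤n (λ i → p (suc i)))
... | false = m≤n⇒m≤1+n (count≤n (λ i → p (suc i)))

count-pos : ∀ {n} {p : VSet n} i → T (p i) → 1 ≤ count p
count-pos {p = p} zero    r with p zero
... | true = s≤s z≤n
count-pos {p = p} (suc i) r with p zero
... | true  = s≤s z≤n
... | false = count-pos i r

halfOf-fold : ∀ {n} (p : VSet n) z →
              foldFin n (λ i c → if p i then pred (pred c) else c) z ≡ z ∸ 2 * count p
halfOf-fold {zero}  p z = refl
halfOf-fold {suc n} p z with p zero | halfOf-fold (λ i → p (suc i)) z
... | false | ih = ih
... | true  | ih rewrite ih = trans (cong pred (pred[m∸n]≡m∸[1+n] z (2 * c)))
  (trans (pred[m∸n]≡m∸[1+n] z (suc (2 * c)))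
         (cong (z ∸_) (cong suc (sym (+-suc c (c + 0))))))
  where c = count (λ i → p (suc i))

halfOf⁻ : ∀ {n} {p q : VSet n} → T (halfOf p q) → 2 * count p ≤ count q
halfOf⁻ {p = p} {q} r rewrite halfOf-fold p (suc (count q)) =
  s≤s⁻¹ (m∸n≢0⇒n<m (λ eq → neg⁻ r (subst (λ x → T (isZero x)) (sym eq) tt)))

halfOf⁺ : ∀ {n} {p q : VSet n} → 2 * count p ≤ count q → T (halfOf p q)
halfOf⁺ {p = p} {q} h rewrite halfOf-fold p (suc (count q)) =
  neg⁺ (λ r → <⇒≢ (m<n⇒0<n∸m (s≤s h)) (sym (isZero⁻ r)))

lookup-injective : ∀ {A : Set} {xs : List A} → Unique xs → ∀ i j →
                   lookup xs i ≡ lookup xs j → i ≡ j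
lookup-injective (x ∷ u) zero    zero    eq = refl
lookup-injective (x ∷ u) zero    (suc j) eq = contradiction eq (All.lookup x (∈-lookup j))
lookup-injective (x ∷ u) (suc i) zero    eq = contradiction (sym eq) (All.lookup x (∈-lookup i))
lookup-injective (x ∷ u) (suc i) (suc j) eq = cong suc (lookup-injective u i j eq)

iter : ∀ {A : Set} → ℕ → (A → A) → A → A
iter zero    f z = z
iter (suc m) f z = f (iter m f z)

foldFin-const : ∀ {A : Set} m (f : A → A) z → foldFin m (λ _ → f) z ≡ iter m f z
foldFin-const zero    f z = refl
foldFin-const (suc m) f z = cong f (foldFin-const m f z)

module _ {n} {G : Graph n} where

  infixr 5 _++ʷ_
  _++ʷ_ : ∀ {u v w} → Walk G u v → Walk G v w → Walk G u w
  stop     ++ʷ q = q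
  step a p ++ʷ q = step a (p ++ʷ q)

  edges-++ʷ : ∀ {u v w} (p : Walk G u v) (q : Walk G v w) → edges (p ++ʷ q) ≡ edges p + edges q
  edges-++ʷ stop       q = refl
  edges-++ʷ (step a p) q = cong suc (edges-++ʷ p q)

  Adj-sym : ∀ {u v} → Adj G u v → Adj G v u
  Adj-sym {u} {v} = subst T (Graph.sym G u v)

  Adj-irrefl : ∀ {u} → ¬ Adj G u u
  Adj-irrefl {u} a = subst T (Graph.irrefl G u) a

  reverseʷ : ∀ {u v} → Walk G u v → Walk G v u
  reverseʷ stop       = stop
  reverseʷ (step a p) = reverseʷ p ++ʷ step (Adj-sym a) stop

  edges-reverseʷ : ∀ {u v} (p : Walk G u v) → edges (reverseʷ p) ≡ edges p
  edges-reverseʷ stop       = refl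
  edges-reverseʷ (step a p) = trans (edges-++ʷ (reverseʷ p) _)
    (trans (+-comm (edges (reverseʷ p)) 1) (cong suc (edges-reverseʷ p)))

  start∈ : ∀ {u v} (p : Walk G u v) → u ∈ vertices p
  start∈ stop       = here refl
  start∈ (step _ _) = here refl

  end∈ : ∀ {u v} (p : Walk G u v) → v ∈ vertices p
  end∈ stop       = here refl
  end∈ (step _ p) = there (end∈ p)

  -- Keeping track of the vertices ensures that the path avoids whatever the walk avoids.
  PathWithin : ∀ {u v} → Walk G u v → Fin n → Set
  PathWithin {v = v} p x =
    Σ[ q ∈ Walk G x v ] IsPath q × edges q ≤ edges p × (∀ {y} → y ∈ vertices q → y ∈ vertices p)

  suffix : ∀ {u v x} (p : Walk G u v) → IsPath p → x ∈ vertices p → PathWithin p x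
  suffix stop       up       (here refl) = stop , up , ≤-refl , λ z → z
  suffix (step a p) up       (here refl) = step a p , up , ≤-refl , λ z → z
  suffix (step a p) (_ ∷ up) (there x∈)  with suffix p up x∈
  ... | q , uq , q≤p , q⊆p = q , uq , m≤n⇒m≤1+n q≤p , λ z → there (q⊆p z)

  shorten : ∀ {u v} (p : Walk G u v) → PathWithin p u
  shorten stop = stop , ([] ∷ []) , z≤n , λ z → z
  shorten {u} (step a p) with shorten p
  ... | q , uq , q≤p , q⊆p with DecMembership._∈?_ _≟_ u (vertices q)
  ...   | yes u∈q with suffix q uq u∈q
  ...     | r , ur , r≤q , r⊆q = r , ur , m≤n⇒m≤1+n (≤-trans r≤q q≤p) , λ z → there (q⊆p (r⊆q z))
  shorten {u} (step a p) | q , uq , q≤p , q⊆p | no u∉q =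
    step a q , (¬Any⇒All¬ _ u∉q ∷ uq) , s≤s q≤p , λ { (here refl) → here refl ; (there z) → there (q⊆p z) }

  length-vertices : ∀ {u v} (p : Walk G u v) → length (vertices p) ≡ suc (edges p)
  length-vertices stop       = refl
  length-vertices (step _ p) = cong suc (length-vertices p)

  -- Pigeonhole: the vertices of a path form an injection into `Fin n`.
  path<n : ∀ {u v} (p : Walk G u v) → IsPath p → edges p < n
  path<n p up = subst (_≤ n) (length-vertices p)
    (injective⇒≤ {f = lookup (vertices p)} (lookup-injective up _ _))

  short : ∀ {u v} (p : Walk G u v) → Σ[ q ∈ Walk G u v ] edges q ≤ edges p × edges q < n
  short p with shorten p
  ... | q , uq , q≤p , _ = q , q≤p , path<n q uq

mapʷ : ∀ {n} {G H : Graph n} → SpanningSubgraph G H → ∀ {u v} → Walk G u v → Walk H u v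
mapʷ s stop       = stop
mapʷ s (step a p) = step (s _ _ a) (mapʷ s p)

edges-mapʷ : ∀ {n} {G H : Graph n} (s : SpanningSubgraph G H) {u v} (p : Walk G u v) →
             edges (mapʷ {G = G} {H} s p) ≡ edges p
edges-mapʷ s stop       = refl
edges-mapʷ s (step a p) = cong suc (edges-mapʷ s p)

ball : ∀ {n} → ℕ → Rel n → Rel n
ball m R = iter m (expand R) same

module _ {n} (G : Graph n) where

  ball-suc : ∀ m {u v} → T (ball m (adj G) u v) → T (ball (suc m) (adj G) u v)
  ball-suc m p = or⁺ˡ p

  ball-mono : ∀ {m m′ u v} → m ≤ m′ → T (ball m (adj G) u v) → T (ball m′ (adj G) u v)
  ball-mono {m} {m′} m≤m′ p with ≤⇒≤′ m≤m′
  ... | ≤′-refl = p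
  ... | ≤′-step {m″} q = ball-suc m″ (ball-mono (≤′⇒≤ q) p)

  ball⁻ : ∀ m {u v} → T (ball m (adj G) u v) → Σ[ p ∈ Walk G u v ] edges p ≤ m
  ball⁻ zero {u} {v} p with same⁻ {i = u} {v} p
  ... | refl = stop , z≤n
  ball⁻ (suc m) {u} {v} p with or⁻ {ball m (adj G) u v} p
  ... | inj₁ q with ball⁻ m q
  ...   | w , h = w , m≤n⇒m≤1+n h
  ball⁻ (suc m) {u} {v} p | inj₂ q with anyFin⁻ q
  ... | w , r with and⁻ {ball m (adj G) u w} r
  ...   | s , a with ball⁻ m s
  ...     | x , h = x ++ʷ step a stop ,
      ≤-trans (≤-reflexive (trans (edges-++ʷ x _) (+-comm (edges x) 1))) (s≤s h)

  ball-extend : ∀ m {u v w} (p : Walk G v w) → T (ball m (adj G) u v) →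
                T (ball (edges p + m) (adj G) u w)
  ball-extend m stop q = q
  ball-extend m {u} {v} {w} (step {v = v′} a p) q =
    subst (λ x → T (ball x (adj G) u w)) (+-suc (edges p) m)
      (ball-extend (suc m) p (or⁺ʳ {ball m (adj G) u v′} (anyFin⁺ v (and⁺ q a))))

  ball⁺ : ∀ {m u v} (p : Walk G u v) → edges p ≤ m → T (ball m (adj G) u v)
  ball⁺ {m} {u} {v} p h = ball-mono h
    (subst (λ x → T (ball x (adj G) u v)) (+-identityʳ (edges p)) (ball-extend 0 {u} p (same⁺ {i = u} refl)))

  closure≡ball : closure (adj G) ≡ ball n (adj G)
  closure≡ball = foldFin-const n (expand (adj G)) same

  closure⁺ : ∀ {u v} → Walk G u v → T (closure (adj G) u v)
  closure⁺ {u} {v} p with short p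
  ... | q , _ , q<n = subst (λ R → T (R u v)) (sym closure≡ball) (ball⁺ q (<⇒≤ q<n))

  closure⁻ : ∀ {u v} → T (closure (adj G) u v) → Walk G u v
  closure⁻ {u} {v} p = proj₁ (ball⁻ n (subst (λ R → T (R u v)) closure≡ball p))

  -- The radius is lowered while the smaller ball still contains v; since balls are monotone in the
  -- radius, the first failure is final.
  least-ball : ∀ m {u v} → T (ball m (adj G) u v) →
               ∃[ d ] d ≤ m × T (ball d (adj G) u v) × (∀ d′ → T (ball d′ (adj G) u v) → d ≤ d′)
  least-ball zero    p = 0 , z≤n , p , λ _ _ → z≤n
  least-ball (suc m) {u} {v} p with T? (ball m (adj G) u v)
  ... | no ¬q = suc m , ≤-refl , p , λ d′ q → ≰⇒> (λ d′≤m → ¬q (ball-mono d′≤m q))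
  ... | yes q with least-ball m q
  ...   | d , d≤m , r = d , m≤n⇒m≤1+n d≤m , r

  shortest : ∀ {u v} (p : Walk G u v) → ∃[ d ] Dist G u v d × d ≤ edges p
  shortest p with least-ball (edges p) (ball⁺ p ≤-refl)
  ... | d , d≤ , b , min with ball⁻ d b
  ...   | q , q≤d = d , ((q , ≤-antisym q≤d (min _ (ball⁺ q ≤-refl))) , λ r → min _ (ball⁺ r ≤-refl)) , d≤

-- Forests

module _ {n} (H : Graph n) where

  Avoiding : (x y p q : Fin n) → Set
  Avoiding x y p q = Adj H p q × ¬ (p ≡ x × q ≡ y) × ¬ (p ≡ y × q ≡ x)

  -- Every edge is a bridge. No distinctness of vertices is involved, which makes this form of
  -- acyclicity convenient when edges are added.
  Forest : Set
  Forest = ∀ x y → Adj H x y → ¬ Star (Avoiding x y) x y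

  star⇒walk : ∀ {x y u v} → Star (Avoiding x y) u v → Walk H u v
  star⇒walk ε             = stop
  star⇒walk ((a , _) ◅ s) = step a (star⇒walk s)

  avoid-start : ∀ {u v w} (p : Walk H w v) → All (u ≢_) (vertices p) → Star (Avoiding u v) w v
  avoid-start stop       _               = ε
  avoid-start (step a p) (u≢w ∷ u∉p) =
    (a , (λ { (w≡u , _) → u≢w (sym w≡u) })
       , (λ { (_ , x≡u) → All.lookup u∉p (start∈ p) (sym x≡u) }))
    ◅ avoid-start p u∉p

  -- The path of a cycle joins the ends u and v of the closing edge without using that edge: its
  -- first edge does not end at v, and the later ones do not meet u.
  forest⇒acyclic : Forest → Acyclic H
  forest⇒acyclic f stop _ ()
  forest⇒acyclic f (step a stop) _ (s≤s ())
  forest⇒acyclic f {u} {v} (step {v = w} a (step b p)) (u∉ ∷ (w∉ ∷ _)) _ c =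
    f u v (Adj-sym {G = H} c)
      ((a , (λ { (_ , w≡v) → All.lookup w∉ (end∈ p) w≡v })
          , (λ { (_ , w≡u) → All.lookup u∉ (start∈ (step {G = H} b p)) (sym w≡u) }))
       ◅ avoid-start (step b p) u∉)

module _ {n} (par : Fin n → Fin n) where

  parent-edges⁻ : ∀ {u v} → T (parent-edges par u v) → (par u ≡ v ⊎ par v ≡ u) × u ≢ v
  parent-edges⁻ {u} {v} p with and⁻ {neg (same u v)} p
  ... | q , r with or⁻ {same (par u) v} r
  ...   | inj₁ s = inj₁ (same⁻ {i = par u} {v} s) , λ u≡v → neg⁻ q (same⁺ {i = u} u≡v)
  ...   | inj₂ s = inj₂ (same⁻ {i = par v} {u} s) , λ u≡v → neg⁻ q (same⁺ {i = u} u≡v)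

  parent-edges⁺ : ∀ {u v} → par u ≡ v ⊎ par v ≡ u → u ≢ v → T (parent-edges par u v)
  parent-edges⁺ {u} {v} h u≢v = and⁺ {neg (same u v)} (neg⁺ (λ s → u≢v (same⁻ {i = u} {v} s))) (cases h)
    where
    cases : par u ≡ v ⊎ par v ≡ u → T (same (par u) v or same (par v) u)
    cases (inj₁ e) = or⁺ˡ {same (par u) v} (same⁺ {i = par u} e)
    cases (inj₂ e) = or⁺ʳ {same (par u) v} (same⁺ {i = par v} e)

  swap-parent : ∀ {u v} → T (parent-edges par u v) → T (parent-edges par v u)
  swap-parent {u} {v} p with parent-edges⁻ {u} {v} p
  ... | inj₁ e , ne = parent-edges⁺ {v} {u} (inj₂ e) (λ e′ → ne (sym e′))
  ... | inj₂ e , ne = parent-edges⁺ {v} {u} (inj₁ e) (λ e′ → ne (sym e′))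

  parent-graph : Graph n
  parent-graph = record
    { adj    = parent-edges par
    ; sym    = λ u v → T-ext (swap-parent {u} {v}) (swap-parent {v} {u})
    ; irrefl = λ u → T-ext {b = false} (λ p → proj₂ (parent-edges⁻ {u} {u} p) refl) (λ ())
    }

  data Descendant (x : Fin n) : Fin n → Set where
    here : Descendant x x
    down : ∀ {z} → Descendant x (par z) → Descendant x z

  module _ (rk : Fin n → ℕ) (decreasing : ∀ z → par z ≢ z → rk (par z) < rk z) where

    rank-≤ : ∀ {x z} → Descendant x z → rk x ≤ rk z
    rank-≤ here = ≤-refl
    rank-≤ {x} (down {z} d) with par z ≟ z
    ... | yes e = subst (λ w → rk x ≤ rk w) e (rank-≤ d)
    ... | no ne = ≤-trans (rank-≤ d) (<⇒≤ (decreasing z ne))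

    -- The only edge leaving the descendants of x is the one to its parent.
    descendants-closed : ∀ {x y u v} → par x ≡ y → Star (Avoiding parent-graph x y) u v →
                         Descendant x u → Descendant x v
    descendants-closed e ε d = d
    descendants-closed {x} {y} {u} e (_◅_ {j = w} (a , ne , _) s) d =
      descendants-closed e s (move d (proj₁ (parent-edges⁻ {u} {w} a)) ne)
      where
      move : ∀ {u w} → Descendant x u → par u ≡ w ⊎ par w ≡ u →
             ¬ (u ≡ x × w ≡ y) → Descendant x w
      move d        (inj₂ refl) _  = down d
      move here     (inj₁ refl) ne = contradiction (refl , e) ne
      move (down d) (inj₁ refl) _  = d

    no-return : ∀ {x y} → par x ≡ y → x ≢ y → ¬ Descendant x y
    no-return refl x≢y d =
      <⇒≱ (decreasing _ (λ e → x≢y (sym e))) (rank-≤ d)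

    swap-avoiding : ∀ {x y u v} → Star (Avoiding parent-graph x y) u v →
                    Star (Avoiding parent-graph y x) v u
    swap-avoiding = go ε
      where
      go : ∀ {x y u v w} → Star (Avoiding parent-graph y x) u w →
           Star (Avoiding parent-graph x y) u v → Star (Avoiding parent-graph y x) v w
      go acc ε = acc
      go acc (_◅_ {i = i} {j} (a , f , g) s) =
        go ((swap-parent {i} {j} a , (λ { (e , e′) → f (e′ , e) }) , (λ { (e , e′) → g (e′ , e) })) ◅ acc) s

    -- If y is the parent of x, a walk from x that avoids the edge between them stays among the
    -- descendants of x, whereas y has smaller rank than x.
    parent-forest : Forest parent-graph
    parent-forest x y a s with parent-edges⁻ {x} {y} a
    ... | inj₁ e , ne = no-return e ne (descendants-closed e s here)
    ... | inj₂ e , ne = no-return e (λ e′ → ne (sym e′)) (descendants-closed e (swap-avoiding s) here)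

-- Joining two components of a forest by an edge.

module _ {n} (H : Graph n) (a b : Fin n) where

  Added : Fin n → Fin n → Set
  Added u v = (u ≡ a × v ≡ b) ⊎ (u ≡ b × v ≡ a)

  add-edge⁻ : ∀ {u v} → T (add-edge (adj H) a b u v) → Adj H u v ⊎ Added u v
  add-edge⁻ {u} {v} p with or⁻ {adj H u v} p
  ... | inj₁ q = inj₁ q
  ... | inj₂ q with or⁻ {same u a and same v b} q
  ...   | inj₁ r with and⁻ {same u a} r
  ...     | s , t = inj₂ (inj₁ (same⁻ {i = u} s , same⁻ {i = v} t))
  add-edge⁻ {u} {v} p | inj₂ q | inj₂ r with and⁻ {same u b} r
  ...     | s , t = inj₂ (inj₂ (same⁻ {i = u} s , same⁻ {i = v} t))

  add-edge-old : ∀ {u v} → Adj H u v → T (add-edge (adj H) a b u v)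
  add-edge-old p = or⁺ˡ p

  add-edge-new : ∀ {u v} → Added u v → T (add-edge (adj H) a b u v)
  add-edge-new {u} {v} (inj₁ (e , e′)) =
    or⁺ʳ {adj H u v} (or⁺ˡ {same u a and same v b} (and⁺ {same u a} (same⁺ {i = u} e) (same⁺ {i = v} e′)))
  add-edge-new {u} {v} (inj₂ (e , e′)) =
    or⁺ʳ {adj H u v} (or⁺ʳ {same u a and same v b} (and⁺ {same u b} (same⁺ {i = u} e) (same⁺ {i = v} e′)))

  swap-add : ∀ {u v} → T (add-edge (adj H) a b u v) → T (add-edge (adj H) a b v u)
  swap-add {u} {v} p with add-edge⁻ {u} {v} p
  ... | inj₁ q                = add-edge-old {v} {u} (Adj-sym {G = H} q)
  ... | inj₂ (inj₁ (e , e′)) = add-edge-new {v} {u} (inj₂ (e′ , e))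
  ... | inj₂ (inj₂ (e , e′)) = add-edge-new {v} {u} (inj₁ (e′ , e))

  add-edge-graph : a ≢ b → Graph n
  add-edge-graph a≢b = record
    { adj    = add-edge (adj H) a b
    ; sym    = λ u v → T-ext (swap-add {u} {v}) (swap-add {v} {u})
    ; irrefl = λ u → T-ext {b = false} (λ p → loopless (add-edge⁻ {u} {u} p)) (λ ())
    }
    where
    loopless : ∀ {u} → ¬ (Adj H u u ⊎ Added u u)
    loopless (inj₁ q)                  = Adj-irrefl {G = H} q
    loopless (inj₂ (inj₁ (refl , e′))) = a≢b e′
    loopless (inj₂ (inj₂ (refl , e′))) = a≢b (sym e′)

  module _ (f : Forest H) (unconnected : ¬ Walk H a b) (a≢b : a ≢ b) where

    private
      H′ : Graph n
      H′ = add-edge-graph a≢b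

    -- A walk that uses the new edge twice could be shortcut.
    use-once : ∀ {x y u v} → Star (Avoiding H′ x y) u v →
      Star (Avoiding H x y) u v
      ⊎ (Star (Avoiding H x y) u a × Star (Avoiding H x y) b v)
      ⊎ (Star (Avoiding H x y) u b × Star (Avoiding H x y) a v)
    use-once ε = inj₁ ε
    use-once (_◅_ {i = u} {w} (p , ne , ne′) s) with add-edge⁻ {u} {w} p | use-once s
    ... | inj₁ q | inj₁ t                 = inj₁ ((q , ne , ne′) ◅ t)
    ... | inj₁ q | inj₂ (inj₁ (t , t′))   = inj₂ (inj₁ ((q , ne , ne′) ◅ t , t′))
    ... | inj₁ q | inj₂ (inj₂ (t , t′))   = inj₂ (inj₂ ((q , ne , ne′) ◅ t , t′))
    ... | inj₂ (inj₁ (refl , refl)) | inj₁ t               = inj₂ (inj₁ (ε , t))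
    ... | inj₂ (inj₁ (refl , refl)) | inj₂ (inj₁ (_ , t′)) = inj₂ (inj₁ (ε , t′))
    ... | inj₂ (inj₁ (refl , refl)) | inj₂ (inj₂ (_ , t′)) = inj₁ t′
    ... | inj₂ (inj₂ (refl , refl)) | inj₁ t               = inj₂ (inj₂ (ε , t))
    ... | inj₂ (inj₂ (refl , refl)) | inj₂ (inj₁ (_ , t′)) = inj₁ t′
    ... | inj₂ (inj₂ (refl , refl)) | inj₂ (inj₂ (_ , t′)) = inj₂ (inj₂ (ε , t′))

    avoid-new : ∀ {x y u v} → (∀ {p q} → Added p q → (p ≡ x × q ≡ y) ⊎ (p ≡ y × q ≡ x)) →
                Star (Avoiding H′ x y) u v → Walk H u v
    avoid-new h ε = stop
    avoid-new h (_◅_ {i = u} {w} (p , ne , ne′) s) with add-edge⁻ {u} {w} p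
    ... | inj₁ q = step q (avoid-new h s)
    ... | inj₂ q with h q
    ...   | inj₁ e = contradiction e ne
    ...   | inj₂ e = contradiction e ne′

    -- A detour around the new edge would join a to b in H. A detour around an old edge xy either
    -- lies in H, or it uses the new edge once; then its two other parts and xy join a to b in H.
    add-edge-forest : Forest H′
    add-edge-forest x y e s with add-edge⁻ {x} {y} e
    ... | inj₂ (inj₁ (refl , refl)) = unconnected (avoid-new (λ z → z) s)
    ... | inj₂ (inj₂ (refl , refl)) =
      unconnected (reverseʷ (avoid-new (λ { (inj₁ z) → inj₂ z ; (inj₂ z) → inj₁ z }) s))
    ... | inj₁ q with use-once s
    ...   | inj₁ t = f x y q t
    ...   | inj₂ (inj₁ (t , t′)) = unconnected
      (reverseʷ (star⇒walk H t) ++ʷ step q (reverseʷ (star⇒walk H t′)))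
    ...   | inj₂ (inj₂ (t , t′)) = unconnected
      (star⇒walk H t′ ++ʷ step (Adj-sym {G = H} q) (star⇒walk H t))

foldFin-rule : ∀ {A : Set} {m} {f : Fin m → A → A} {z} (P : A → Set) →
               (∀ i {x} → P x → P (f i x)) → P z → P (foldFin m f z)
foldFin-rule {m = zero}  P h p = p
foldFin-rule {m = suc m} P h p = h zero (foldFin-rule P (λ i → h (suc i)) p)

-- Here P is a loop invariant and E j is what step j achieves and the other steps preserve; at the
-- end every E j holds.
foldFin-establish : ∀ {A : Set} {m} {f : Fin m → A → A} {z} (P : A → Set) (E : Fin m → A → Set) →
  (∀ i {x} → P x → P (f i x)) → (∀ i {x} → P x → E i (f i x)) →
  (∀ i j {x} → P x → E j x → E j (f i x)) → P z → ∀ j → E j (foldFin m f z)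
foldFin-establish {m = suc m} P E h e k p zero    = e zero (foldFin-rule P (λ i → h (suc i)) p)
foldFin-establish {m = suc m} P E h e k p (suc j) =
  k zero (suc j) (foldFin-rule P (λ i → h (suc i)) p)
    (foldFin-establish P (λ i → E (suc i)) (λ i → h (suc i)) (λ i → e (suc i))
      (λ i j → k (suc i) (suc j)) p j)

-- Extending a forest to a spanning tree.

module _ {n} (G F : Graph n) where

  Good : Rel n → Set
  Good M = Σ[ H ∈ Graph n ] adj H ≡ M × Forest H × SpanningSubgraph H G × SpanningSubgraph F H

  Linked : Fin n → Fin n → Rel n → Set
  Linked a b M = Adj G a b → T (closure M a b)

  span-step-spec : ∀ a b {M} → Good M → Good (span-step (adj G) a b M)
                   × (∀ u v → T (M u v) → T (span-step (adj G) a b M u v))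
                   × Linked a b (span-step (adj G) a b M)
  span-step-spec a b {M} (H , refl , f , H⊆G , F⊆H)
    with T? (adj G a b) | T? (closure (adj H) a b)
  ... | yes g | no ¬c rewrite T-ext {adj G a b and neg (closure (adj H) a b)} {true} (λ _ → tt) (λ _ → and⁺ g (neg⁺ ¬c)) =
    (add-edge-graph H a b a≢b , refl
      , add-edge-forest H a b f (λ w → ¬c (closure⁺ H w)) a≢b
      , H′⊆G , (λ u v e → add-edge-old H a b {u} {v} (F⊆H u v e)))
    , (λ u v → add-edge-old H a b {u} {v})
    , (λ _ → closure⁺ (add-edge-graph H a b a≢b) (step (add-edge-new H a b {a} {b} (inj₁ (refl , refl))) stop))
    where
    a≢b : a ≢ b
    a≢b refl = Adj-irrefl {G = G} g
    H′⊆G : SpanningSubgraph (add-edge-graph H a b a≢b) G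
    H′⊆G u v e with add-edge⁻ H a b {u} {v} e
    ... | inj₁ q                  = H⊆G u v q
    ... | inj₂ (inj₁ (refl , refl)) = g
    ... | inj₂ (inj₂ (refl , refl)) = Adj-sym {G = G} g
  ... | yes g | yes c rewrite T-ext {adj G a b and neg (closure (adj H) a b)} {false} (λ q → neg⁻ (proj₂ (and⁻ {adj G a b} q)) c) (λ ()) =
    (H , refl , f , H⊆G , F⊆H) , (λ _ _ e → e) , (λ _ → c)
  ... | no ¬g | _ rewrite T-ext {adj G a b and neg (closure (adj H) a b)} {false} (λ q → ¬g (proj₁ (and⁻ {adj G a b} q))) (λ ()) =
    (H , refl , f , H⊆G , F⊆H) , (λ _ _ e → e) , (λ g → contradiction g ¬g)

  closure-mono : ∀ {M M′} → Good M → Good M′ → (∀ u v → T (M u v) → T (M′ u v)) →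
                 ∀ {u v} → T (closure M u v) → T (closure M′ u v)
  closure-mono (H , refl , _) (H′ , refl , _) s c = closure⁺ H′ (mapʷ {G = H} {H′} s (closure⁻ H c))

  span-step-keeps : ∀ a b c d {M} → Good M → Linked c d M → Linked c d (span-step (adj G) a b M)
  span-step-keeps a b c d {M} g l e with span-step-spec a b g
  ... | g′ , s , _ = closure-mono g g′ s (l e)

  -- After both loops the ends of every edge of G are connected in H, so each walk in G can be
  -- followed in H.
  span-spec : Connected G → Forest F → SpanningSubgraph F G →
              Σ[ H ∈ Graph n ] adj H ≡ span (adj G) (adj F) × SpanningTree H G × SpanningSubgraph F H
  span-spec (n≢0 , connected) f F⊆G with
    foldFin-rule {f = λ a M → foldFin n (λ b M → span-step (adj G) a b M) M} {z = adj F} Good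
      (λ a → foldFin-rule Good (λ b g → proj₁ (span-step-spec a b g)))
      (F , refl , f , F⊆G , λ _ _ e → e)
  ... | H , refl , f′ , H⊆G , F⊆H =
    H , refl , (H⊆G , (n≢0 , λ u v → follow (connected u v)) , forest⇒acyclic H f′) , F⊆H
    where
    inner : ∀ a {M} → Good M → Good (foldFin n (λ b M → span-step (adj G) a b M) M)
    inner a = foldFin-rule Good (λ b g → proj₁ (span-step-spec a b g))
    linked : ∀ a b → Linked a b (adj H)
    linked = foldFin-establish {f = λ a M → foldFin n (λ b M → span-step (adj G) a b M) M} {z = adj F}
      Good (λ a M → ∀ b → Linked a b M) inner
      (λ a g → foldFin-establish Good (λ b → Linked a b)
        (λ b g → proj₁ (span-step-spec a b g))
        (λ b g → proj₂ (proj₂ (span-step-spec a b g)))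
        (λ b c → span-step-keeps a b a c) g)
      (λ a c {M} g l d → proj₂ (foldFin-rule {f = λ b M → span-step (adj G) a b M} {z = M}
        (λ M → Good M × Linked c d M)
        (λ b (g , l) → proj₁ (span-step-spec a b g) , span-step-keeps a b c d g l)
        (g , l d)))
      (F , refl , f , F⊆G , λ _ _ e → e)
    follow : ∀ {u v} → Walk G u v → Walk H u v
    follow stop       = stop
    follow (step e p) = closure⁻ H (linked _ _ e) ++ʷ follow p

-- Breadth-first search

if-true : ∀ {A : Set} {b} {x y : A} → T b → (if b then x else y) ≡ x
if-true {b = true} _ = refl

if-false : ∀ {A : Set} {b} {x y : A} → ¬ T b → (if b then x else y) ≡ y
if-false {b = false} _ = refl
if-false {b = true}  h = contradiction tt h

first-none : ∀ {A : Set} {m} (p : Fin m → Bool) (g : Fin m → A) d →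
             (∀ i → ¬ T (p i)) → select p g d ≡ d
first-none {m = zero}  p g d h = refl
first-none {m = suc m} p g d h =
  trans (if-false (h zero)) (first-none (λ i → p (suc i)) (λ i → g (suc i)) d (λ i → h (suc i)))

module _ {n} (K : Graph n) (X₀ : VSet n) where

  state : ℕ → VSet n × (Fin n → Fin n)
  state m = iter m (bfs-step (adj K)) (X₀ , λ u → u)

  reached : ℕ → VSet n
  reached m = proj₁ (state m)

  parent : ℕ → Fin n → Fin n
  parent m = proj₂ (state m)

  reached-mono : ∀ {j m z} → j ≤ m → T (reached j z) → T (reached m z)
  reached-mono {j} {m} j≤m p with ≤⇒≤′ j≤m
  ... | ≤′-refl = p
  ... | ≤′-step q = or⁺ˡ (reached-mono (≤′⇒≤ q) p)

  reached-walk : ∀ j {u v} (p : Walk K u v) → T (reached j u) → T (reached (edges p + j) v)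
  reached-walk j stop r = r
  reached-walk j {u} {v} (step {v = w} a p) r =
    subst (λ x → T (reached x v)) (+-suc (edges p) j)
      (reached-walk (suc j) p (or⁺ʳ {reached j w} (anyFin⁺ u (and⁺ r a))))

  -- The rank of a reached vertex is the round in which it was reached. It drops from a vertex to
  -- its parent, which makes the parent graph a forest, and it bounds the depth.
  record Layered (m : ℕ) : Set where
    field
      rank       : Fin n → ℕ
      rank≤      : ∀ {z} → T (reached m z) → rank z ≤ m
      descends   : ∀ {z} → T (reached m z) → (T (X₀ z) × parent m z ≡ z)
                   ⊎ (Adj K (parent m z) z × T (reached m (parent m z)) × rank (parent m z) < rank z)
      unreached  : ∀ {z} → ¬ T (reached m z) → parent m z ≡ z
      rank≤layer : ∀ {j z} → j ≤ m → T (reached j z) → rank z ≤ j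

  layered : ∀ m → Layered m
  layered zero = record
    { rank       = λ _ → 0
    ; rank≤      = λ _ → z≤n
    ; descends   = λ r → inj₁ (r , refl)
    ; unreached  = λ _ → refl
    ; rank≤layer = λ _ _ → z≤n
    }
  layered (suc m) = record
    { rank       = rank′
    ; rank≤      = rank′≤
    ; descends   = descends′
    ; unreached  = λ {z} ¬r → trans
        (if-false {b = reached m z} (λ r → ¬r (or⁺ˡ r)))
        (first-none (candidate z) (λ i → i) z (λ i c → ¬r (or⁺ʳ {reached m z} (anyFin⁺ i c))))
    ; rank≤layer = layer
    }
    where
    open Layered (layered m)
    candidate : Fin n → Fin n → Bool
    candidate z w = reached m w and adj K w z
    -- All vertices not reached by round m get rank m + 1, whether or not they are reached now.
    rank′ : Fin n → ℕ
    rank′ z = if reached m z then rank z else suc m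
    rank-old : ∀ {z} → T (reached m z) → rank′ z ≡ rank z
    rank-old = if-true
    rank-new : ∀ {z} → ¬ T (reached m z) → rank′ z ≡ suc m
    rank-new = if-false
    rank′≤ : ∀ {z} → T (reached (suc m) z) → rank′ z ≤ suc m
    rank′≤ {z} _ with T? (reached m z)
    ... | yes r = subst (_≤ suc m) (sym (rank-old {z} r)) (m≤n⇒m≤1+n (rank≤ r))
    ... | no ¬r = ≤-reflexive (rank-new {z} ¬r)
    layer : ∀ {j z} → j ≤ suc m → T (reached j z) → rank′ z ≤ j
    layer {j} {z} j≤ r with ≤⇒≤′ j≤
    ... | ≤′-refl   = rank′≤ {z} r
    ... | ≤′-step q = subst (_≤ j) (sym (rank-old {z} (reached-mono (≤′⇒≤ q) r))) (rank≤layer (≤′⇒≤ q) r)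
    descends′ : ∀ {z} → T (reached (suc m) z) → (T (X₀ z) × parent (suc m) z ≡ z)
      ⊎ (Adj K (parent (suc m) z) z × T (reached (suc m) (parent (suc m) z))
         × rank′ (parent (suc m) z) < rank′ z)
    descends′ {z} r′ with T? (reached m z)
    ... | yes r with descends r
    ...   | inj₁ (x , e) = inj₁ (x , trans (if-true r) e)
    ...   | inj₂ (a , rp , lt) = inj₂ (subst P (sym (if-true r)) (a , or⁺ˡ rp
            , subst₂ _<_ (sym (rank-old {parent m z} rp)) (sym (rank-old {z} r)) lt))
      where
      P : Fin n → Set
      P w = Adj K w z × T (reached (suc m) w) × rank′ w < rank′ z
    descends′ {z} r′ | no ¬r with or⁻ {reached m z} r′
    ... | inj₁ r = contradiction r ¬r
    ... | inj₂ c with anyFin⁻ c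
    ...   | w , cw with and⁻ {reached m (first (candidate z) z)} (first-spec (candidate z) z w cw)
    ...     | rp , a = inj₂ (subst P (sym (if-false ¬r)) (a , or⁺ˡ rp
              , subst₂ _<_ (sym (rank-old {first (candidate z) z} rp)) (sym (rank-new {z} ¬r)) (s≤s (rank≤ rp))))
      where
      P : Fin n → Set
      P w = Adj K w z × T (reached (suc m) w) × rank′ w < rank′ z

  bfs-forest : Graph n
  bfs-forest = parent-graph (bfs (adj K) X₀)

  private
    bfs≡parent : bfs (adj K) X₀ ≡ parent n
    bfs≡parent = cong proj₂ (foldFin-const n (bfs-step (adj K)) (X₀ , λ u → u))

  open Layered (layered n)

  parent-descends : ∀ z → parent n z ≢ z → Adj K (parent n z) z × rank (parent n z) < rank z
  parent-descends z ne with T? (reached n z)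
  ... | no ¬r = contradiction (unreached ¬r) ne
  ... | yes r with descends r
  ...   | inj₁ (_ , e)      = contradiction e ne
  ...   | inj₂ (a , _ , lt) = a , lt

  -- Following parents ends at a root because ranks drop; `e` is the fuel of the recursion.
  climb : ∀ e {z} → rank z ≤ e → T (reached n z) →
          Σ[ x ∈ Fin n ] T (X₀ x) × (Σ[ p ∈ Walk (parent-graph (parent n)) x z ] edges p ≤ rank z)
  climb e {z} _ r with descends r
  climb e {z} _ r | inj₁ (x , _) = z , x , stop , z≤n
  climb zero    {z} h r | inj₂ (a , rp , lt) = contradiction (≤-trans lt h) λ ()
  climb (suc e) {z} h r | inj₂ (a , rp , lt) with climb e (s≤s⁻¹ (≤-trans lt h)) rp
  ... | x , x∈ , p , p≤ = x , x∈ , p ++ʷ step up stop ,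
        ≤-trans (≤-reflexive (trans (edges-++ʷ p _) (+-comm (edges p) 1))) (≤-trans (s≤s p≤) lt)
    where
    up : T (parent-edges (parent n) (parent n z) z)
    up = parent-edges⁺ (parent n) {parent n z} {z} (inj₂ refl)
           (λ e → <-irrefl (cong rank e) lt)

  -- With several roots the vertex z may hang below a root x other than b, but it is no deeper than
  -- its distance from b.
  bfs-spec : Forest bfs-forest × SpanningSubgraph bfs-forest K ×
    (∀ {b z} → T (X₀ b) → (p : Walk K b z) →
     Σ[ x ∈ Fin n ] T (X₀ x) × (Σ[ q ∈ Walk bfs-forest x z ] edges q ≤ edges p))
  bfs-spec rewrite bfs≡parent =
    parent-forest (parent n) rank (λ z ne → proj₂ (parent-descends z ne)) , edge , close
    where
    edge : SpanningSubgraph (parent-graph (parent n)) K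
    edge u v e with parent-edges⁻ (parent n) {u} {v} e
    ... | inj₁ refl , ne = Adj-sym {G = K} (proj₁ (parent-descends u (λ e → ne (sym e))))
    ... | inj₂ refl , ne = proj₁ (parent-descends v ne)
    close : ∀ {b z} → T (X₀ b) → (p : Walk K b z) →
            Σ[ x ∈ Fin n ] T (X₀ x) × (Σ[ q ∈ Walk (parent-graph (parent n)) x z ] edges q ≤ edges p)
    close {b} {z} x p with short p
    ... | q , q≤p , q<n with subst (λ j → T (reached j z)) (+-identityʳ (edges q)) (reached-walk 0 q x)
    ...   | r with climb (rank z) ≤-refl (reached-mono (<⇒≤ q<n) r)
    ...     | y , y∈ , w , w≤ = y , y∈ , w ,
              ≤-trans w≤ (≤-trans (rank≤layer (<⇒≤ q<n) r) q≤p)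

-- Balanced separators from a tree-decomposition

some-vertex : ∀ {n} → NonZero n → Fin n
some-vertex {suc n} _ = zero

argmin : ∀ {m} (f : Fin (suc m) → ℕ) → ∃[ i ] (∀ j → f i ≤ f j)
argmin {zero}  f = zero , λ { zero → ≤-refl }
argmin {suc m} f with argmin (λ i → f (suc i))
... | i , min with ≤-total (f zero) (f (suc i))
...   | inj₁ h = zero , λ { zero → ≤-refl ; (suc j) → ≤-trans h (min j) }
...   | inj₂ h = suc i , λ { zero → h ; (suc j) → min j }

sumOver : ∀ {n} → VSet n → (Fin n → ℕ) → ℕ
sumOver C a = foldFin _ (λ v s → if C v then a v + s else s) 0

-- Here b and a are the distances before and after a move along a tree edge. Vertices of P get
-- closer by one, the rest of C recedes by at most one, so the sum changes by at most |C| - 2|P|.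
sumOver-shift : ∀ {n} (C P : VSet n) (a b : Fin n → ℕ) → (∀ v → T (P v) → T (C v)) →
                (∀ v → T (P v) → suc (a v) ≤ b v) → (∀ v → a v ≤ suc (b v)) →
                sumOver C a + 2 * count P ≤ sumOver C b + count C
sumOver-shift {zero}  C P a b P⊆C closer near = z≤n
sumOver-shift {suc n} C P a b P⊆C closer near
  with C zero | P zero | P⊆C zero | closer zero
     | sumOver-shift (λ v → C (suc v)) (λ v → P (suc v)) (λ v → a (suc v)) (λ v → b (suc v))
         (λ v → P⊆C (suc v)) (λ v → closer (suc v)) (λ v → near (suc v))
... | false | true  | h | _ | _  = ⊥-elim (h tt)
... | false | false | _ | _ | ih = ih
... | true  | false | _ | _ | ih = begin
  a zero + sa + 2 * p   ≡⟨ +-assoc (a zero) sa (2 * p) ⟩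
  a zero + (sa + 2 * p) ≤⟨ +-mono-≤ (near zero) ih ⟩
  suc (b zero) + (sb + c) ≡⟨ cong suc (sym (+-assoc (b zero) sb c)) ⟩
  suc (b zero + sb + c)   ≡⟨ sym (+-suc (b zero + sb) c) ⟩
  b zero + sb + suc c ∎
  where
  open ≤-Reasoning
  sa = sumOver (λ v → C (suc v)) (λ v → a (suc v))
  sb = sumOver (λ v → C (suc v)) (λ v → b (suc v))
  c = count (λ v → C (suc v))
  p = count (λ v → P (suc v))
... | true  | true  | _ | h | ih = begin
  a zero + sa + 2 * suc p       ≡⟨ solve 3 (λ x y z → x :+ y :+ con 2 :* (con 1 :+ z) := con 1 :+ x :+ (con 1 :+ (y :+ con 2 :* z))) refl (a zero) sa p ⟩
  suc (a zero) + suc (sa + 2 * p) ≤⟨ +-mono-≤ (h tt) (s≤s ih) ⟩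
  b zero + suc (sb + c)           ≡⟨ solve 3 (λ x y z → x :+ (con 1 :+ (y :+ z)) := x :+ y :+ (con 1 :+ z)) refl (b zero) sb c ⟩
  b zero + sb + suc c ∎
  where
  open ≤-Reasoning
  sa = sumOver (λ v → C (suc v)) (λ v → a (suc v))
  sb = sumOver (λ v → C (suc v)) (λ v → b (suc v))
  c = count (λ v → C (suc v))
  p = count (λ v → P (suc v))

split : ∀ {n} {G : Graph n} {u v x} (p : Walk G u v) → x ∈ vertices p →
        Σ[ q ∈ Walk G u x ] Σ[ r ∈ Walk G x v ] edges q + edges r ≡ edges p
split stop       (here refl) = stop , stop , refl
split (step a p) (here refl) = stop , step a p , refl
split (step a p) (there x∈) with split p x∈
... | q , r , e = step a q , r , cong suc e

++ʷ-vertices : ∀ {n} {G : Graph n} {u v w x} (p : Walk G u v) (q : Walk G v w) →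
               x ∈ vertices (p ++ʷ q) → x ∈ vertices p ⊎ x ∈ vertices q
++ʷ-vertices stop       q x∈         = inj₂ x∈
++ʷ-vertices (step a p) q (here e)   = inj₁ (here e)
++ʷ-vertices (step a p) q (there x∈) with ++ʷ-vertices p q x∈
... | inj₁ y = inj₁ (there y)
... | inj₂ y = inj₂ y

reverseʷ-vertices : ∀ {n} {G : Graph n} {u v x} (p : Walk G u v) →
                    x ∈ vertices (reverseʷ p) → x ∈ vertices p
reverseʷ-vertices stop x∈ = x∈
reverseʷ-vertices (step a p) x∈ with ++ʷ-vertices (reverseʷ p) _ x∈
... | inj₁ y = there (reverseʷ-vertices p y)
... | inj₂ (here refl) = there (start∈ p)
... | inj₂ (there (here e)) = here e

-- Distances and branches in a tree.

module Tree {m} (𝕋 : Graph m) (isTree : IsTree 𝕋) where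

  private
    connected : ∀ i j → Walk 𝕋 i j
    connected = proj₂ (proj₁ isTree)

  dist : Fin m → Fin m → ℕ
  dist i j = proj₁ (shortest 𝕋 (connected i j))

  geodesic : ∀ i j → Σ[ p ∈ Walk 𝕋 i j ] edges p ≡ dist i j
  geodesic i j = proj₁ (proj₁ (proj₂ (shortest 𝕋 (connected i j))))

  dist≤ : ∀ {i j} (p : Walk 𝕋 i j) → dist i j ≤ edges p
  dist≤ {i} {j} = proj₂ (proj₁ (proj₂ (shortest 𝕋 (connected i j))))

  dist-step : ∀ {i j} l → Adj 𝕋 i j → dist j l ≤ suc (dist i l)
  dist-step {i} {j} l a with geodesic i l
  ... | p , e = subst (λ x → dist j l ≤ suc x) e (dist≤ (step (Adj-sym {G = 𝕋} a) p))

  -- For a neighbour j of i this says that l lies in the branch of j at i. Stated through distances,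
  -- it can be tested by a Boolean.
  Towards : (i j l : Fin m) → Set
  Towards i j l = suc (dist j l) ≡ dist i l

  towards : ∀ {i l} → i ≢ l → ∃[ j ] Adj 𝕋 i j × Towards i j l
  towards {i} {l} i≢l with geodesic i l
  ... | stop , _ = contradiction refl i≢l
  ... | step {v = j} a p , e = j , a , ≤-antisym
    (subst (suc (dist j l) ≤_) e (s≤s (dist≤ p)))
    (dist-step l (Adj-sym {G = 𝕋} a))

  geodesic-avoids : ∀ {i j l} → Towards i j l → (p : Walk 𝕋 j l) → edges p ≡ dist j l →
                    i ∉ vertices p
  geodesic-avoids to p e i∈ with split p i∈
  ... | q , r , e′ = <⇒≱ (≤-reflexive to)
    (≤-trans (dist≤ r) (subst (edges r ≤_) (trans e′ e) (m≤n+m (edges r) (edges q))))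

  -- Two different first edges at i would close a cycle.
  towards-same : ∀ {i j l l′} → Adj 𝕋 i j → (q : Walk 𝕋 l l′) → i ∉ vertices q →
                 Towards i j l → Towards i j l′
  towards-same {i} {j} {l} {l′} a q i∉q to with towards {i} {l′} (λ { refl → i∉q (end∈ q) })
  ... | j′ , a′ , to′ with j ≟ j′
  ...   | yes refl = to′
  ...   | no j≢j′ = ⊥-elim (cycle (shorten detour))
    where
    p : Walk 𝕋 j l
    p = proj₁ (geodesic j l)
    p′ : Walk 𝕋 j′ l′
    p′ = proj₁ (geodesic j′ l′)
    detour : Walk 𝕋 j j′
    detour = p ++ʷ q ++ʷ reverseʷ p′
    i∉ : i ∉ vertices detour
    i∉ i∈ with ++ʷ-vertices p (q ++ʷ reverseʷ p′) i∈
    ... | inj₁ x = geodesic-avoids to p (proj₂ (geodesic j l)) x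
    ... | inj₂ x with ++ʷ-vertices q (reverseʷ p′) x
    ...   | inj₁ y = i∉q y
    ...   | inj₂ y = geodesic-avoids to′ p′ (proj₂ (geodesic j′ l′)) (reverseʷ-vertices p′ y)
    cycle : ¬ PathWithin detour j
    cycle (stop , _) = j≢j′ refl
    cycle (step b r , ur , _ , r⊆) =
      proj₂ isTree (step a (step b r)) (¬Any⇒All¬ _ (λ i∈ → i∉ (r⊆ i∈)) ∷ ur) (s≤s (s≤s z≤n)) (Adj-sym {G = 𝕋} a′)

elements : ∀ {n} → Subset n → List (Fin n)
elements []            = []
elements (inside  ∷ p) = zero ∷ map suc (elements p)
elements (outside ∷ p) = map suc (elements p)

length-elements : ∀ {n} (p : Subset n) → length (elements p) ≡ ∣ p ∣
length-elements []            = refl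
length-elements (inside  ∷ p) = cong suc (trans (length-map suc (elements p)) (length-elements p))
length-elements (outside ∷ p) = trans (length-map suc (elements p)) (length-elements p)

∈-elements : ∀ {n} {p : Subset n} {v} → v Subset.∈ p → v ∈ elements p
∈-elements {p = inside  ∷ p} Vec.here      = here refl
∈-elements {p = inside  ∷ p} (Vec.there x) = there (∈-map⁺ suc (∈-elements x))
∈-elements {p = outside ∷ p} (Vec.there x) = ∈-map⁺ suc (∈-elements x)

-- The search ranges over tuples of exactly k centres, so a smaller bag is filled up with an
-- arbitrary vertex.
padded : ∀ {n k} (p : Subset n) → Fin n → ∣ p ∣ ≤ k →
         Σ[ bs ∈ List (Fin n) ] length bs ≡ k × (∀ {v} → v Subset.∈ p → v ∈ bs)
padded {k = k} p d h = elements p ++ replicate (k ∸ ∣ p ∣) d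
  , trans (length-++ (elements p))
      (trans (cong₂ _+_ (length-elements p) (length-replicate (k ∸ ∣ p ∣))) (m+[n∸m]≡n h))
  , λ v∈ → ∈-++⁺ˡ (∈-elements v∈)

-- The source of the radius: two pieces longer than ⌈t/2⌉ would together exceed ⌊t/2⌋ + ⌈t/2⌉ = t.
≤-half : ∀ {a b t} → a + b ≤ t → a ≤ ⌈ t /2⌉ ⊎ b ≤ ⌈ t /2⌉
≤-half {a} {b} {t} h with ≤-<-connex a ⌈ t /2⌉ | ≤-<-connex b ⌈ t /2⌉
... | inj₁ p | _      = inj₁ p
... | _      | inj₁ q = inj₂ q
... | inj₂ p | inj₂ q = contradiction
  (<-≤-trans (+-mono-< p q) (≤-trans h
    (subst (_≤ ⌈ t /2⌉ + ⌈ t /2⌉) (⌊n/2⌋+⌈n/2⌉≡n t) (+-monoˡ-≤ ⌈ t /2⌉ (⌊n/2⌋≤⌈n/2⌉ t)))))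
  (<-irrefl refl)

restricted : ∀ {n} → Graph n → VSet n → Graph n
restricted G A = record
  { adj    = restrict (adj G) A
  ; sym    = λ u v → T-ext (swap {u} {v}) (swap {v} {u})
  ; irrefl = λ u → T-ext {b = false} (λ p → Adj-irrefl {G = G} (proj₁ (and⁻ {adj G u u} p))) (λ ())
  }
  where
  swap : ∀ {u v} → T (restrict (adj G) A u v) → T (restrict (adj G) A v u)
  swap {u} {v} p with and⁻ {adj G u v} p
  ... | a , q with and⁻ {A u} q
  ...   | x , y = and⁺ (Adj-sym {G = G} a) (and⁺ y x)

restricted⁻ : ∀ {n} (G : Graph n) (A : VSet n) {u v} → Adj (restricted G A) u v → Adj G u v × T (A u) × T (A v)
restricted⁻ G A {u} {v} p with and⁻ {adj G u v} p
... | a , q with and⁻ {A u} q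
...   | x , y = a , x , y

restricted-end : ∀ {n} (G : Graph n) (A : VSet n) {u v} → Walk (restricted G A) u v → T (A u) → T (A v)
restricted-end G A stop       x = x
restricted-end G A (step {u} {v} a p) x = restricted-end G A p (proj₂ (proj₂ (restricted⁻ G A {u} {v} a)))

balanced⁺ : ∀ {n} (R : Rel n) (C X : VSet n) →
  (∀ u → T ((C ∖ X) u) → 2 * count (closure (restrict R (C ∖ X)) u) ≤ count C) →
  T (balanced R C X)
balanced⁺ R C X h = neg⁺ refute
  where
  refute : ¬ T (anyFin λ u → (C ∖ X) u and neg (halfOf (closure (restrict R (C ∖ X)) u) C))
  refute r with anyFin⁻ r
  ... | u , s with and⁻ {(C ∖ X) u} s
  ...   | y , z = neg⁻ z (halfOf⁺ {p = closure (restrict R (C ∖ X)) u} (h u y))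

balanced⁻ : ∀ {n} (R : Rel n) (C X : VSet n) → T (balanced R C X) →
  ∀ u → T ((C ∖ X) u) → 2 * count (closure (restrict R (C ∖ X)) u) ≤ count C
balanced⁻ R C X b u y with T? (halfOf (closure (restrict R (C ∖ X)) u) C)
... | yes z = halfOf⁻ {p = closure (restrict R (C ∖ X)) u} z
... | no ¬z = contradiction (anyFin⁺ u (and⁺ {(C ∖ X) u} y (neg⁺ ¬z))) (neg⁻ b)

-- Disks around a bag of the spanner's decomposition.

module Separator {n} (G H : Graph n) (t k : ℕ) (1≤k : 1 ≤ k) (connected : Connected G)
  (spanner : IsSpanner t G H) (D : TreeDecomposition H)
  (width≡ : TreeDecomposition.width D ≡ k ∸ 1) where

  open TreeDecomposition D renaming (tree to 𝕋)
  open Tree 𝕋 isTree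

  home : Fin n → Fin size
  home v = proj₁ (covers-vertex v)

  bag-size : ∀ i → ∣ bag i ∣ ≤ k
  bag-size i = begin
    ∣ bag i ∣                                ≤⟨ All.lookup (xs≤max 0 sizes) (∈-tabulate⁺ i) ⟩
    max 0 sizes                              ≤⟨ m≤n+m∸n (max 0 sizes) 1 ⟩
    1 + (max 0 sizes ∸ 1)                    ≡⟨ cong suc width≡ ⟩
    1 + (k ∸ 1)                              ≡⟨ m+[n∸m]≡n 1≤k ⟩
    k ∎
    where
    open ≤-Reasoning
    sizes = tabulate (λ i → ∣ bag i ∣)

  -- If the path from l to l′ passed through i, coherence would put v into the bag of i.
  avoiding-bag : ∀ {i l l′ v} → ¬ v Subset.∈ bag i → v Subset.∈ bag l → v Subset.∈ bag l′ →
                 Σ[ q ∈ Walk 𝕋 l l′ ] i ∉ vertices q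
  avoiding-bag {i} {l} {l′} v∉ v∈l v∈l′ with shorten (proj₁ (geodesic l l′))
  ... | q , uq , _ = q , λ i∈ → v∉ (coherent q uq i∈ (x∈p∩q⁺ (v∈l , v∈l′)))

  -- From the home of u one gets to a node whose bag holds both ends, and from there to the home of
  -- v, without meeting i; so the branch at i stays the same.
  towards-edge : ∀ {i j u v} → Adj 𝕋 i j → Adj H u v → ¬ u Subset.∈ bag i → ¬ v Subset.∈ bag i →
                 Towards i j (home u) → Towards i j (home v)
  towards-edge {u = u} {v} a e u∉ v∉ to with covers-edge u v e
  ... | l , u∈ , v∈ with avoiding-bag u∉ (proj₂ (covers-vertex u)) u∈ | avoiding-bag v∉ v∈ (proj₂ (covers-vertex v))
  ...   | q , i∉q | q′ , i∉q′ = towards-same a q′ i∉q′ (towards-same a q i∉q to)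

  towards-walk : ∀ {i j u v} → Adj 𝕋 i j → (p : Walk H u v) →
                 (∀ {x} → x ∈ vertices p → ¬ x Subset.∈ bag i) →
                 Towards i j (home u) → Towards i j (home v)
  towards-walk a stop       h to = to
  towards-walk a (step e p) h to = towards-walk a p (λ x∈ → h (there x∈))
    (towards-edge a e (h (here refl)) (h (there (start∈ p))) to)

  short-detour : ∀ {u v} → Adj G u v → Σ[ p ∈ Walk H u v ] edges p ≤ t
  short-detour {u} {v} a with proj₂ spanner u v 1 ((step a stop , refl) , far)
    where
    far : ∀ (p : Walk G u v) → 1 ≤ edges p
    far stop       = ⊥-elim (Adj-irrefl {G = G} a)
    far (step _ _) = s≤s z≤n
  ... | e , ((p , refl) , _) , h = p , ≤-trans h (≤-reflexive (*-identityʳ t))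

  separator : ∀ (C : VSet n) → Σ[ bs ∈ List (Fin n) ] length bs ≡ k ×
    (∀ (X : VSet n) → (∀ {b v} → b ∈ bs → (p : Walk G b v) → edges p ≤ ⌈ t /2⌉ → T (X v)) →
     T (balanced (adj G) C X))
  separator C = proj₁ cover , proj₁ (proj₂ cover) , λ X covered →
    balanced⁺ (adj G) C X (small X covered)
    where
    minimiser : ∃[ i ] (∀ j → sumOver C (λ v → dist i (home v)) ≤ sumOver C (λ v → dist j (home v)))
    minimiser = go (proj₁ (proj₁ isTree)) (λ i → sumOver C (λ v → dist i (home v)))
      where
      go : ∀ {m} → NonZero m → (f : Fin m → ℕ) → ∃[ i ] (∀ j → f i ≤ f j)
      go {suc m} _ f = argmin f
    i = proj₁ minimiser
    cover = padded (bag i) (some-vertex (proj₁ connected)) (bag-size i)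
    branch : Fin size → VSet n
    branch j v = C v and (suc (dist j (home v)) ≡ᵇ dist i (home v))
    branch-half : ∀ {j} → Adj 𝕋 i j → 2 * count (branch j) ≤ count C
    -- By minimality, moving from i to its neighbour j does not lower the sum; the shift then leaves
    -- 2|P| ≤ |C| for the branch P.
    branch-half {j} a = +-cancelˡ-≤ (sumOver C (λ v → dist i (home v))) _ _
      (≤-trans (+-monoˡ-≤ (2 * count (branch j)) (proj₂ minimiser j))
        (sumOver-shift C (branch j) (λ v → dist j (home v)) (λ v → dist i (home v))
          (λ v p → proj₁ (and⁻ {C v} p))
          (λ v p → ≤-reflexive (≡ᵇ⇒≡ _ _ (proj₂ (and⁻ {C v} p))))
          (λ v → dist-step (home v) a)))
    module _ (X : VSet n)
      (covered : ∀ {b v} → b ∈ proj₁ cover → (p : Walk G b v) → edges p ≤ ⌈ t /2⌉ → T (X v)) where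
      Y : VSet n
      Y = C ∖ X
      K : Graph n
      K = restricted G Y
      in-C : ∀ {v} → T (Y v) → T (C v)
      in-C {v} y = proj₁ (and⁻ {C v} y)
      uncovered : ∀ {v} → T (Y v) → ¬ T (X v)
      uncovered {v} y = neg⁻ (proj₂ (and⁻ {C v} y))
      H⊆G : ∀ {u v} (p : Walk H u v) → Σ[ q ∈ Walk G u v ] edges q ≡ edges p
      H⊆G p = mapʷ {G = H} {G} (proj₁ spanner) p , edges-mapʷ {G = H} {G} (proj₁ spanner) p
      outside-bag : ∀ {v} → T (Y v) → ¬ v Subset.∈ bag i
      outside-bag y v∈ = uncovered y (covered (proj₂ (proj₂ cover) v∈) stop z≤n)
      -- A vertex of the bag on the detour would be within ⌈t/2⌉ of u or of v, first in H and hence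
      -- in G, so that end would be covered.
      detour-avoids : ∀ {u v} → T (Y u) → T (Y v) → (p : Walk H u v) → edges p ≤ t →
                      ∀ {x} → x ∈ vertices p → ¬ x Subset.∈ bag i
      detour-avoids yu yv p h x∈ x∈bag with split p x∈
      ... | q , r , e with ≤-half {edges q} {edges r} (subst (_≤ t) (sym e) h)
      ...   | inj₁ q≤ with H⊆G (reverseʷ q)
      ...     | q′ , e′ = uncovered yu (covered (proj₂ (proj₂ cover) x∈bag) q′
                (subst (_≤ ⌈ t /2⌉) (sym (trans e′ (edges-reverseʷ q))) q≤))
      detour-avoids yu yv p h x∈ x∈bag | q , r , e | inj₂ r≤ with H⊆G r
      ...     | r′ , e′ = uncovered yv (covered (proj₂ (proj₂ cover) x∈bag) r′
                (subst (_≤ ⌈ t /2⌉) (sym e′) r≤))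
      towards-component : ∀ {j u v} → Adj 𝕋 i j → Walk K u v → Towards i j (home u) → Towards i j (home v)
      towards-component a stop to = to
      towards-component a (step {u} {w} e p) to with restricted⁻ G Y {u} {w} e
      ... | e′ , yu , yw with short-detour e′
      ...   | q , q≤t = towards-component a p
                (towards-walk a q (detour-avoids yu yw q q≤t) to)
      small : ∀ u → T (Y u) → 2 * count (closure (restrict (adj G) Y) u) ≤ count C
      small u y with towards {i} {home u} (λ i≡ → outside-bag y
                       (subst (λ l → u Subset.∈ bag l) (sym i≡) (proj₂ (covers-vertex u))))
      ... | j , a , to = ≤-trans (*-monoʳ-≤ 2 (count-mono inside-branch)) (branch-half a)
        where
        inside-branch : ∀ v → T (closure (restrict (adj G) Y) u v) → T (branch j v)
        inside-branch v c with closure⁻ K c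
        ... | p = and⁺ {C v} (in-C (restricted-end G Y p y)) (≡⇒≡ᵇ _ _ (towards-component a p to))

-- The search for separators

cover : ∀ {n} → Rel n → VSet n → List (Fin n) → VSet n
cover D X []       = X
cover D X (b ∷ bs) = cover D (λ v → X v or D b v) bs

cover-⊇ : ∀ {n} (D : Rel n) {X : VSet n} bs {v} → T (X v) → T (cover D X bs v)
cover-⊇ D []       x = x
cover-⊇ D (b ∷ bs) x = cover-⊇ D bs (or⁺ˡ x)

cover⁺ : ∀ {n} (D : Rel n) {X : VSet n} {bs b v} → b ∈ bs → T (D b v) → T (cover D X bs v)
cover⁺ D {X} {b ∷ bs} {v = v} (here refl) x = cover-⊇ D bs (or⁺ʳ {X v} x)
cover⁺ D {bs = _ ∷ bs} (there b∈)  x = cover⁺ D {bs = bs} b∈ x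

centres : ∀ k {n} → Val (tuple k) n → List (Fin n)
centres zero    c        = []
centres (suc k) (b , bs) = b ∷ centres k bs

module _ {n} (R : Rel n) (C : VSet n) (D : Rel n) (d : Fin n) where

  -- The loop over the first centre succeeds as soon as one value does, though possibly with a tuple
  -- other than `bs`.
  search-complete : ∀ k X bs → length bs ≡ k → T (balanced R C (cover D X bs)) →
                    T (proj₁ (search k R C D X d))
  search-complete zero    X []       e b = b
  search-complete (suc k) X (a ∷ bs) e b =
    select-spec (λ x → T (proj₁ x)) (λ i → proj₁ (r i)) (λ i → true , (proj₁ (proj₂ (r i)) , (i , proj₂ (proj₂ (r i)))))
      (false , (X , (d , sem (constant-tuple k x₀) ((((R , C) , D) , X) , d)))) (λ _ _ → tt)
      (a , search-complete k (λ v → X v or D a v) bs (suc-injective e) b)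
    where
    r : Fin n → Outcome k n
    r i = search k R C D (λ v → X v or D i v) d

  Sound : ∀ k → VSet n → Outcome k n → Set
  Sound k X (_ , (X′ , c)) = T (balanced R C X′) ×
    (∀ v → T (X′ v) → T (X v) ⊎ (∃[ b ] b ∈ centres k c × T (D b v)))

  search-sound : ∀ k X → T (proj₁ (search k R C D X d)) → Sound k X (search k R C D X d)
  search-sound zero    X ok = ok , λ v x → inj₁ x
  search-sound (suc k) X =
    foldFin-rule {f = λ i x → if proj₁ (r i) then (true , (proj₁ (proj₂ (r i)) , (i , proj₂ (proj₂ (r i))))) else x}
      {z = false , (X , (d , sem (constant-tuple k x₀) ((((R , C) , D) , X) , d)))}
      (λ x → T (proj₁ x) → Sound (suc k) X x) choice λ ()
    where
    r : Fin n → Outcome k n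
    r i = search k R C D (λ v → X v or D i v) d
    choice : ∀ i {x} → (T (proj₁ x) → Sound (suc k) X x) →
             let y = if proj₁ (r i) then (true , (proj₁ (proj₂ (r i)) , (i , proj₂ (proj₂ (r i))))) else x in
             T (proj₁ y) → Sound (suc k) X y
    choice i h ok with proj₁ (r i) | search-sound k (λ v → X v or D i v)
    ... | false | _ = h ok
    ... | true  | s with s tt
    ...   | b , f = b , λ v x → member v (f v x)
      where
      member : ∀ v → T (X v or D i v) ⊎ (∃[ b ] b ∈ centres k (proj₂ (proj₂ (r i))) × T (D b v)) →
               T (X v) ⊎ (∃[ b ] b ∈ centres (suc k) (i , proj₂ (proj₂ (r i))) × T (D b v))
      member v (inj₂ (b , b∈ , y)) = inj₂ (b , there b∈ , y)
      member v (inj₁ y) with or⁻ {X v} y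
      ... | inj₁ x = inj₁ x
      ... | inj₂ x = inj₂ (i , here refl , x)

module _ {n} (G : Graph n) (k : ℕ) (C : VSet n) (d : Fin n) where

  private
    R = adj G

    attempt : ℕ → Outcome k n
    attempt r = search k R C (ball r R) ∅ d

    run : ℕ → Rel n × Outcome k n
    run m = iter m (choose-step k R C d) (same , (false , (∅ , sem (constant-tuple k x₀) ((R , C) , d))))

    run-ball : ∀ m → proj₁ (run m) ≡ ball m R
    run-ball zero    = refl
    run-ball (suc m) = cong (expand R) (run-ball m)

    -- After m rounds the radii below m have been tried: a success stems from the least one that
    -- works, and a failure means that none works.
    Least : ℕ → Outcome k n → Set
    Least m res =
      (T (proj₁ res) → ∃[ r ] r < m × res ≡ attempt r × (∀ r′ → r′ < r → ¬ T (proj₁ (attempt r′))))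
      × (¬ T (proj₁ res) → ∀ r → r < m → ¬ T (proj₁ (attempt r)))

    least : ∀ m → Least m (proj₂ (run m))
    least zero    = (λ ()) , (λ _ _ ())
    least (suc m) with run m | run-ball m | least m
    ... | D , res | refl | found , missing with T? (proj₁ res)
    ...   | yes ok rewrite if-true {x = res} {y = attempt m} ok =
            (λ _ → let r , r<m , e , f = found ok in r , m≤n⇒m≤1+n r<m , e , f)
            , (λ ¬ok → contradiction ok ¬ok)
    ...   | no ¬ok rewrite if-false {x = res} {y = attempt m} ¬ok =
            (λ _ → m , ≤-refl , refl , missing ¬ok) , λ ¬ok′ r r≤m → fails ¬ok′ r (≤⇒≤′ r≤m)
      where
      fails : ¬ T (proj₁ (attempt m)) → ∀ r → suc r ≤′ suc m → ¬ T (proj₁ (attempt r))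
      fails ¬ok′ r ≤′-refl     = ¬ok′
      fails ¬ok′ r (≤′-step h) = missing ¬ok r (≤′⇒≤ h)

  Halves : ℕ → Outcome k n → Set
  Halves r (_ , (X , c)) = T (balanced R C X) ×
    (∀ v → T (X v) → ∃[ b ] b ∈ centres k c × (Σ[ p ∈ Walk G b v ] edges p ≤ r))

  -- The radius s at which the loop succeeds is the least possible, so s ≤ r even though r is
  -- unknown to the loop.
  choose-spec : ∀ r → r < n → T (proj₁ (search k R C (ball r R) ∅ d)) →
                Halves r (choose k R C d)
  choose-spec r r<n ok = subst (Halves r)
    (sym (cong proj₂ (foldFin-const n (choose-step k R C d)
      (same , (false , (∅ , sem (constant-tuple k x₀) ((R , C) , d)))))))
    result
    where
    result : Halves r (proj₂ (run n))
    result with proj₂ (run n) | least n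
    ... | res | found , missing with T? (proj₁ res)
    ...   | no ¬ok = contradiction ok (missing ¬ok r r<n)
    ...   | yes ok′ with found ok′
    ...     | s , _ , refl , min with search-sound R C (ball s R) d k ∅ ok′
    ...       | b , f = b , λ v x → disk v (f v x)
      where
      disk : ∀ v → T (∅ v) ⊎ (∃[ b ] b ∈ centres k (proj₂ (proj₂ (attempt s))) × T (ball s R b v)) →
             ∃[ b ] b ∈ centres k (proj₂ (proj₂ (attempt s))) × (Σ[ p ∈ Walk G b v ] edges p ≤ r)
      disk v (inj₂ (b , b∈ , y)) with ball⁻ G s y
      ... | p , p≤s = b , b∈ , p , ≤-trans p≤s (≮⇒≥ (λ r<s → min r r<s ok))

Halving : ∀ {n} → Graph n → (k ρ : ℕ) → Set
Halving {n} G k ρ = ∀ (C : VSet n) d → Halves G k C d ρ (choose k (adj G) C d)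

separators⇒halving : ∀ {n} (G : Graph n) k ρ → NonZero n →
  (∀ (C : VSet n) → Σ[ bs ∈ List (Fin n) ] length bs ≡ k ×
    (∀ (X : VSet n) → (∀ {b v} → b ∈ bs → (p : Walk G b v) → edges p ≤ ρ → T (X v)) →
     T (balanced (adj G) C X))) →
  Halving G k ρ
separators⇒halving {suc n} G k ρ _ separator C d with separator C
-- There are n + 1 vertices here, and the radii 0 to n are tried. Capping ρ at n loses nothing,
-- because a walk can be shortened to at most n edges.
... | bs , len , halves with choose-spec G k C d (ρ ⊓ n) (s≤s (m⊓n≤n ρ n))
        (search-complete (adj G) C (ball (ρ ⊓ n) (adj G)) d k ∅ bs len (halves _ covered))
  where
  covered : ∀ {b v} → b ∈ bs → (p : Walk G b v) → edges p ≤ ρ →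
            T (cover (ball (ρ ⊓ n) (adj G)) ∅ bs v)
  covered b∈ p p≤ρ with short p
  ... | q , q≤p , q<n = cover⁺ (ball (ρ ⊓ n) (adj G)) {bs = bs} b∈
        (ball⁺ G q (⊓-glb (≤-trans q≤p p≤ρ) (s≤s⁻¹ q<n)))
... | b , f = b , λ v x → let c , c∈ , p , p≤ = f v x in c , c∈ , p , ≤-trans p≤ (m⊓n≤m ρ n)

-- The system of trees

module Level {n} (G : Graph n) (k ρ : ℕ) (connected : Connected G) (halving : Halving G k ρ)
  (A : VSet n) where

  private
    R = adj G
    K = restricted G A
    sol = solution k R A
    rep = representative R A

  centres-of : Fin n → Val (tuple k) n
  centres-of u = proj₂ (proj₂ (sol u))

  rep-walk : ∀ u → Walk K (rep u) u
  rep-walk u = reverseʷ (closure⁻ K (first-spec (closure (adj K) u) u u (closure⁺ K stop)))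

  -- Connected vertices reach the same set, and its first element does not depend on the default
  -- since the set is not empty.
  rep-cong : ∀ {u v} → Walk K u v → rep u ≡ rep v
  rep-cong {u} {v} p = first-cong (closure (adj K) u) (closure (adj K) v) u v v (closure⁺ K p)
    (λ w → T-ext (λ c → closure⁺ K (reverseʷ p ++ʷ closure⁻ K c))
                 (λ c → closure⁺ K (p ++ʷ closure⁻ K c)))

  sol-cong : ∀ {u v} → Walk K u v → sol u ≡ sol v
  sol-cong p = cong (λ w → choose k R (closure (restrict R A) w) w) (rep-cong p)

  next⊆ : ∀ {u} → T (next k R A u) → T (A u)
  next⊆ {u} p = proj₁ (and⁻ {A u} p)

  removed : ∀ {u} → T (A u) → ¬ T (next k R A u) →
            ∃[ b ] b ∈ centres k (centres-of u) × (Σ[ p ∈ Walk G b u ] edges p ≤ ρ)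
  removed {u} a ¬next with T? (proj₁ (proj₂ (sol u)) u)
  ... | yes x = proj₂ (halving (closure (restrict R A) (rep u)) (rep u)) u x
  ... | no ¬x = contradiction (and⁺ a (neg⁺ ¬x)) ¬next

  -- Along a walk that remains active the component of A, and with it the separator X, is constant.
  -- So a new component lies inside one component of the old one minus X.
  next-half : ∀ {v} → T (next k R A v) →
              2 * count (closure (restrict R (next k R A)) v)
              ≤ count (closure (restrict R A) (rep v))
  next-half {v} v∈ = ≤-trans (*-monoʳ-≤ 2 (count-mono
      {p = closure (restrict R (next k R A)) v} {q = closure (restrict R Y) v} (λ z c →
      closure⁺ (restricted G Y) (transport stop v∈ (closure⁻ (restricted G (next k R A)) c)))))
    (balanced⁻ R C X (proj₁ (halving C (rep v))) v (stays stop v∈))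
    where
    C X Y : VSet n
    C = closure (restrict R A) (rep v)
    X = proj₁ (proj₂ (sol v))
    Y = C ∖ X
    stays : ∀ {w} → Walk K v w → T (next k R A w) → T (Y w)
    stays {w} p w∈ = and⁺ (closure⁺ K (rep-walk v ++ʷ p))
      (subst (λ s → T (neg (proj₁ (proj₂ s) w))) (sym (sol-cong p)) (proj₂ (and⁻ {A w} w∈)))
    transport : ∀ {u z} → Walk K v u → T (next k R A u) →
                Walk (restricted G (next k R A)) u z → Walk (restricted G Y) u z
    transport p u∈ stop = stop
    transport {u} p u∈ (step {v = w} a q) with restricted⁻ G (next k R A) {u} {w} a
    ... | g , _ , w∈ = step (and⁺ g (and⁺ (stays p u∈) (stays p′ w∈))) (transport p′ w∈ q)
      where
      p′ : Walk K v w
      p′ = p ++ʷ step (and⁺ {adj G u w} g (and⁺ {A u} (next⊆ {u} u∈) (next⊆ {w} w∈))) stop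

  tree-spec : (c : Fin n → Fin n) → (∀ {u v} → Walk K u v → c u ≡ c v) →
    Σ[ H ∈ Graph n ] adj H ≡ tree R A c × SpanningTree H G ×
      (∀ {z} (p : Walk K (c z) z) → Σ[ q ∈ Walk H (c z) z ] edges q ≤ edges p)
  tree-spec c c-cong with bfs-spec K (λ u → same (c u) u)
  ... | f , F⊆K , near with span-spec G (bfs-forest K (λ u → same (c u) u)) connected f
          (λ u v e → proj₁ (restricted⁻ G A {u} {v} (F⊆K u v e)))
  ...   | H , H≡ , H-tree , F⊆H = H , H≡ , H-tree , close
    where
    F = bfs-forest K (λ u → same (c u) u)
    close : ∀ {z} (p : Walk K (c z) z) → Σ[ q ∈ Walk H (c z) z ] edges q ≤ edges p
    close {z} p with near {c z} (same⁺ {i = c (c z)} (c-cong p)) p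
    -- The root x above z is c z itself: x = c x, as x is a root, and c x = c z, as both lie in one
    -- component.
    ... | x , x∈ , q , q≤p with trans (sym (same⁻ {i = c x} {x} x∈)) (c-cong (mapʷ {G = F} {K} F⊆K q))
    ...   | refl = mapʷ {G = F} {H} F⊆H q
                 , subst (_≤ edges p) (sym (edges-mapʷ {G = F} {H} F⊆H q)) q≤p

  Close : Graph n → Fin n → Fin n → Set
  Close H u b = ∀ {z} → Walk K u z → (p : Walk K b z) → Σ[ q ∈ Walk H b z ] edges q ≤ edges p

  trees-spec : ∀ j (c : Fin n → Val (tuple j) n) → (∀ {u v} → Walk K u v → c u ≡ c v) →
    (𝒯 : List (Graph n)) → All (λ H → SpanningTree H G) 𝒯 →
    Σ[ 𝒯′ ∈ List (Graph n) ] map adj 𝒯′ ≡ trees j R A c (map adj 𝒯) ×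
      length 𝒯′ ≡ j + length 𝒯 × All (λ H → SpanningTree H G) 𝒯′ ×
      (∀ {H} → H ∈ 𝒯 → H ∈ 𝒯′) ×
      (∀ u b → b ∈ centres j (c u) → ∃[ H ] H ∈ 𝒯′ × Close H u b)
  trees-spec zero    c c-cong 𝒯 all = 𝒯 , refl , refl , all , (λ h → h) , λ _ _ ()
  trees-spec (suc j) c c-cong 𝒯 all
    with tree-spec (λ u → proj₁ (c u)) (λ p → cong proj₁ (c-cong p))
       | trees-spec j (λ u → proj₂ (c u)) (λ p → cong proj₂ (c-cong p)) 𝒯 all
  ... | H , H≡ , H-tree , near | 𝒯′ , 𝒯≡ , len , all′ , keep , good =
    H ∷ 𝒯′ , cong₂ _∷_ H≡ 𝒯≡ , cong suc len , H-tree ∷ all′ , (λ h → there (keep h)) , close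
    where
    close : ∀ u b → b ∈ centres (suc j) (c u) → ∃[ H′ ] H′ ∈ (H ∷ 𝒯′) × Close H′ u b
    close u b (there b∈) with good u b b∈
    ... | H′ , H∈ , near′ = H′ , there H∈ , near′
    close u b (here refl) = H , here refl , λ {z} p →
      subst (λ b → (q : Walk K b z) → Σ[ r ∈ Walk H b z ] edges r ≤ edges q)
        (sym (cong proj₁ (c-cong p))) (near {z})

inside-walk : ∀ {n} {G : Graph n} (B : VSet n) {u v w} (p : Walk G u v) →
  (∀ {x} → x ∈ vertices p → T (B x)) → w ∈ vertices p →
  Σ[ q ∈ Walk (restricted G B) u w ] Σ[ r ∈ Walk (restricted G B) w v ] edges q + edges r ≡ edges p
inside-walk B stop h (here refl) = stop , stop , refl
inside-walk B (step a p) h (here refl) with inside-walk B p (λ x → h (there x)) (start∈ p)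
... | q , r , e = stop , step (and⁺ a (and⁺ (h (here refl)) (h (there (start∈ p))))) (q ++ʷ r)
                , cong suc (trans (edges-++ʷ q r) e)
inside-walk B (step a p) h (there w∈) with inside-walk B p (λ x → h (there x)) w∈
... | q , r , e = step (and⁺ a (and⁺ (h (here refl)) (h (there (start∈ p))))) q , r , cong suc e

-- Quantifying over B ⊇ A ∪ {s} expresses that only the last vertex s of the
-- part of the walk lies outside A.
exit : ∀ {n} (G : Graph n) (A : VSet n) {u v} (p : Walk G u v) → T (A u) →
  (Σ[ q ∈ Walk (restricted G A) u v ] edges q ≤ edges p)
  ⊎ (∃[ s ] ¬ T (A s) × (∀ (B : VSet n) → (∀ {x} → T (A x) → T (B x)) → T (B s) →
      Σ[ q ∈ Walk (restricted G B) u s ] edges q ≤ edges p))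
exit G A stop a = inj₁ (stop , z≤n)
exit G A {u} (step {v = w} e p) a with T? (A w)
... | no ¬aw = inj₂ (w , ¬aw , λ B A⊆B s∈ →
        step (and⁺ {adj G u w} e (and⁺ {B u} (A⊆B a) s∈)) stop , s≤s z≤n)
... | yes aw with exit G A p aw
...   | inj₁ (q , h) = inj₁ (step (and⁺ {adj G u w} e (and⁺ {A u} a aw)) q , s≤s h)
...   | inj₂ (s , ¬s , f) = inj₂ (s , ¬s , λ B A⊆B s∈ → let q , h = f B A⊆B s∈ in
        step (and⁺ {adj G u w} e (and⁺ {B u} (A⊆B a) (A⊆B aw))) q , s≤s h)

all-in? : ∀ {n} (A : VSet n) (xs : List (Fin n)) →
          (∀ {x} → x ∈ xs → T (A x)) ⊎ (∃[ x ] x ∈ xs × ¬ T (A x))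
all-in? A [] = inj₁ λ ()
all-in? A (x ∷ xs) with T? (A x) | all-in? A xs
... | no ¬a | _                  = inj₂ (x , here refl , ¬a)
... | yes a | inj₁ h             = inj₁ λ { (here refl) → a ; (there x∈) → h x∈ }
... | yes a | inj₂ (y , y∈ , ¬y) = inj₂ (y , there y∈ , ¬y)

module Algorithm {n} (G : Graph n) (k ρ : ℕ) (connected : Connected G) (halving : Halving G k ρ) where

  private
    R = adj G

  -- H is a nearly shortest path tree for all walks through w that stay in B,
  -- with b in the role of the source.
  Anchor : List (Graph n) → VSet n → ℕ → Fin n → Set
  Anchor 𝒯 A e w = Σ[ H ∈ Graph n ] H ∈ 𝒯 × (Σ[ b ∈ Fin n ] Σ[ B ∈ VSet n ]
    (∀ {x} → T (A x) → T (B x)) × T (B w) ×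
    (∀ {z} (p : Walk (restricted G B) w z) → Σ[ q ∈ Walk H b z ] edges q ≤ edges p + e))

  Served : List (Graph n) → ℕ → ∀ {x y} → Walk G x y → Set
  Served 𝒯 e {x} {y} p =
    Σ[ H ∈ Graph n ] H ∈ 𝒯 × (Σ[ q ∈ Walk H x y ] edges q ≤ edges p + 2 * e)

  Inside : VSet n → ∀ {x y} → Walk G x y → Set
  Inside A p = ∀ {x} → x ∈ vertices p → T (A x)

  -- `level` counts the rounds that began with a non-empty active set. The number of trees and the
  -- error are measured in it, and `level≤` is the form of level ≤ 1 + log₂ n without logarithms.
  record Invariant (m : ℕ) (s : VSet n × List (Rel n)) : Set where
    A = proj₁ s
    field
      𝒯        : List (Graph n)
      𝒯≡       : map adj 𝒯 ≡ proj₂ s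
      level    : ℕ
      length≡  : length 𝒯 ≡ level * k
      level≡   : T (anyFin A) → level ≡ m
      level≤   : 2 ^ level ≤ 2 * n
      small    : ∀ {u} → T (A u) → 2 ^ level * count (closure (restrict R A) u) ≤ n
      spanning : All (λ H → SpanningTree H G) 𝒯
      anchor   : ∀ {w} → ¬ T (A w) → Anchor 𝒯 A (level * ρ) w
      served   : ∀ {x y} (p : Walk G x y) → Inside A p ⊎ Served 𝒯 (level * ρ) p

  -- The walk is cut at w. Both parts, read from w outwards, stay in B, so the tree replaces each by
  -- a walk from b with at most e extra edges; the two are joined at b.
  anchor⇒served : ∀ {𝒯 A e w x y} → Anchor 𝒯 A e w → (p : Walk G x y) → Inside A p →
                  w ∈ vertices p → Served 𝒯 e p
  anchor⇒served {e = e} (H , H∈ , b , B , A⊆B , _ , near) p within w∈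
    with inside-walk B p (λ x∈ → A⊆B (within x∈)) w∈
  ... | q , r , eq with near (reverseʷ q) | near r
  ...   | q′ , q′≤ | r′ , r′≤ = H , H∈ , reverseʷ q′ ++ʷ r′ , (begin
    edges (reverseʷ q′ ++ʷ r′)            ≡⟨ edges-++ʷ (reverseʷ q′) r′ ⟩
    edges (reverseʷ q′) + edges r′        ≡⟨ cong (_+ edges r′) (edges-reverseʷ q′) ⟩
    edges q′ + edges r′                   ≤⟨ +-mono-≤ q′≤ r′≤ ⟩
    edges (reverseʷ q) + e + (edges r + e) ≡⟨ cong (λ x → x + e + (edges r + e)) (edges-reverseʷ q) ⟩
    edges q + e + (edges r + e)           ≡⟨ solve 3 (λ x y z → x :+ z :+ (y :+ z) := x :+ y :+ con 2 :* z) refl (edges q) (edges r) e ⟩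
    edges q + edges r + 2 * e             ≡⟨ cong (_+ 2 * e) eq ⟩
    edges p + 2 * e ∎)
    where open ≤-Reasoning

  module _ (m : ℕ) (A : VSet n) (ts : List (Rel n)) (inv : Invariant m (A , ts))
    (nonempty : T (anyFin A)) where

    open Invariant inv hiding (A)
    open Level G k ρ connected halving A

    private
      A′ = next k R A
      extension = trees-spec k centres-of (λ p → cong (λ s → proj₂ (proj₂ s)) (sol-cong p)) 𝒯 spanning
      𝒯′ = proj₁ extension
      keep = proj₁ (proj₂ (proj₂ (proj₂ (proj₂ extension))))
      close = proj₂ (proj₂ (proj₂ (proj₂ (proj₂ extension))))
      e = level * ρ
      e′ = suc level * ρ

    -- w has been removed because of a centre b; the path from w to b may leave
    -- A, but then through a vertex with an anchor.
    anchor-new : ∀ {w} → T (A w) → ¬ T (A′ w) → Anchor 𝒯′ A e′ w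
    anchor-new {w} w∈ w∉ with removed w∈ w∉
    ... | b , b∈ , p , p≤ρ with exit G A (reverseʷ p) w∈
    ...   | inj₁ (q , q≤) with close w b b∈
    ...     | H , H∈ , near = H , H∈ , b , A , (λ a → a) , w∈ , λ {z} r →
      let s , s≤ = near r (reverseʷ q ++ʷ r) in s , (begin
        edges s                          ≤⟨ s≤ ⟩
        edges (reverseʷ q ++ʷ r)         ≡⟨ edges-++ʷ (reverseʷ q) r ⟩
        edges (reverseʷ q) + edges r     ≡⟨ +-comm (edges (reverseʷ q)) (edges r) ⟩
        edges r + edges (reverseʷ q)     ≡⟨ cong (edges r +_) (edges-reverseʷ q) ⟩
        edges r + edges q                ≤⟨ +-monoʳ-≤ (edges r) (≤-trans q≤ (≤-trans (≤-reflexive (edges-reverseʷ p)) p≤ρ)) ⟩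
        edges r + ρ                      ≤⟨ +-monoʳ-≤ (edges r) (m≤m+n ρ e) ⟩
        edges r + e′ ∎)
      where open ≤-Reasoning
    anchor-new {w} w∈ w∉ | b , b∈ , p , p≤ρ | inj₂ (s , s∉ , part) with anchor s∉
    ... | H , H∈ , b′ , B , A⊆B , s∈B , near with part B A⊆B s∈B
    ...   | q , q≤ = H , keep H∈ , b′ , B , A⊆B , A⊆B w∈ , λ {z} r →
      let t , t≤ = near (reverseʷ q ++ʷ r) in t , (begin
        edges t                              ≤⟨ t≤ ⟩
        edges (reverseʷ q ++ʷ r) + e         ≡⟨ cong (_+ e) (edges-++ʷ (reverseʷ q) r) ⟩
        edges (reverseʷ q) + edges r + e     ≡⟨ cong (λ x → x + edges r + e) (edges-reverseʷ q) ⟩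
        edges q + edges r + e                ≡⟨ solve 3 (λ x y z → x :+ y :+ z := y :+ (x :+ z)) refl (edges q) (edges r) e ⟩
        edges r + (edges q + e)              ≤⟨ +-monoʳ-≤ (edges r) (+-monoˡ-≤ e (≤-trans q≤ (≤-trans (≤-reflexive (edges-reverseʷ p)) p≤ρ))) ⟩
        edges r + e′ ∎)
      where open ≤-Reasoning

    step-nonempty : Invariant (suc m) (A′ , trees k R A centres-of ts)
    step-nonempty = record
      { 𝒯        = 𝒯′
      ; 𝒯≡       = trans (proj₁ (proj₂ extension)) (cong (trees k R A centres-of) 𝒯≡)
      ; level    = suc level
      ; length≡  = trans (proj₁ (proj₂ (proj₂ extension))) (cong (k +_) length≡)
      ; level≡   = λ _ → cong suc (level≡ nonempty)
      -- A round starts only with an active vertex, whose component counts at least 1; so 2 ^ level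
      -- ≤ n before the round, and both sides double.
      ; level≤   = *-monoʳ-≤ 2 (power≤ (anyFin⁻ nonempty))
      ; small    = λ {u} u∈ → small′ {u} u∈
      ; spanning = proj₁ (proj₂ (proj₂ (proj₂ extension)))
      ; anchor   = λ {w} w∉ → anchor′ {w} w∉
      ; served   = served′
      }
      where
      power≤ : (∃[ u ] T (A u)) → 2 ^ level ≤ n
      power≤ (u , u∈) = ≤-trans
        (≤-trans (≤-reflexive (sym (*-identityʳ (2 ^ level))))
          (*-monoʳ-≤ (2 ^ level) (count-pos u (closure⁺ (restricted G A) {u} stop))))
        (small u∈)
      small′ : ∀ {u} → T (A′ u) → 2 ^ suc level * count (closure (restrict R A′) u) ≤ n
      small′ {u} u∈ = begin
        2 * 2 ^ level * c′                ≡⟨ solve 2 (λ x y → con 2 :* x :* y := x :* (con 2 :* y)) refl (2 ^ level) c′ ⟩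
        2 ^ level * (2 * c′)              ≤⟨ *-monoʳ-≤ (2 ^ level) (next-half u∈) ⟩
        2 ^ level * count (closure (restrict R A) (representative R A u))
          ≤⟨ small (restricted-end G A (reverseʷ (rep-walk u)) (next⊆ {u} u∈)) ⟩
        n ∎
        where
        open ≤-Reasoning
        c′ = count (closure (restrict R A′) u)
      anchor′ : ∀ {w} → ¬ T (A′ w) → Anchor 𝒯′ A′ e′ w
      anchor′ {w} w∉ with T? (A w)
      ... | yes w∈ = let H , H∈ , b , B , A⊆B , rest = anchor-new w∈ w∉ in
                     H , H∈ , b , B , (λ {x} x∈ → A⊆B (next⊆ {x} x∈)) , rest
      ... | no ¬w∈ = let H , H∈ , b , B , A⊆B , w∈B , near = anchor ¬w∈ in
                     H , keep H∈ , b , B , (λ {x} x∈ → A⊆B (next⊆ {x} x∈)) , w∈B ,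
                     λ p → let q , q≤ = near p in q , ≤-trans q≤ (+-monoʳ-≤ (edges p) (m≤n+m e ρ))
      served′ : ∀ {x y} (p : Walk G x y) → Inside A′ p ⊎ Served 𝒯′ e′ p
      served′ p with served p
      ... | inj₂ (H , H∈ , q , q≤) = inj₂ (H , keep H∈ , q ,
            ≤-trans q≤ (+-monoʳ-≤ (edges p) (*-monoʳ-≤ 2 (m≤n+m e ρ))))
      -- A walk inside A that now loses a vertex w is served by the anchor that w has just received.
      ... | inj₁ within with all-in? A′ (vertices p)
      ...   | inj₁ within′ = inj₁ within′
      ...   | inj₂ (w , w∈ , w∉) = inj₂ (anchor⇒served (anchor-new (within w∈) w∉) p within w∈)

  invariant : ∀ m → Invariant m (iter m (advance k R) ((λ _ → true) , []))
  invariant zero = record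
    { 𝒯        = []
    ; 𝒯≡       = refl
    ; level    = 0
    ; length≡  = refl
    ; level≡   = λ _ → refl
    ; level≤   = ≤-trans (>-nonZero⁻¹ n {{proj₁ connected}}) (m≤m+n n (n + 0))
    ; small    = λ {u} _ → ≤-trans (≤-reflexive (*-identityˡ _)) (count≤n (closure (restrict R (λ _ → true)) u))
    ; spanning = []
    ; anchor   = λ w∉ → contradiction tt w∉
    ; served   = λ p → inj₁ (λ _ → tt)
    }
  invariant (suc m) with iter m (advance k R) ((λ _ → true) , []) | invariant m
  ... | A , ts | inv with T? (anyFin A)
  ...   | yes nonempty = subst (Invariant (suc m)) (sym (if-true nonempty)) (step-nonempty m A ts inv nonempty)
  ...   | no empty = subst (Invariant (suc m)) (sym (if-false empty)) (record
    { Invariant inv hiding (A; level≡) ; level≡ = λ nonempty → contradiction nonempty empty })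

-- Raising to the power c before taking the logarithm gives 2 ^ (cL) ≤ m ^ c, in the form of the
-- rounded bounds of the theorem.
2^≤⇒≤log : ∀ {L m} c → 2 ^ L ≤ m → c * L ≤ ⌊log₂ m ^ c ⌋
2^≤⇒≤log {L} {m} c h = begin
  c * L                    ≡⟨ *-comm c L ⟩
  L * c                    ≡⟨ sym (⌊log₂[2^n]⌋≡n (L * c)) ⟩
  ⌊log₂ 2 ^ (L * c) ⌋      ≡⟨ cong ⌊log₂_⌋ (sym (^-*-assoc 2 L c)) ⟩
  ⌊log₂ (2 ^ L) ^ c ⌋      ≤⟨ ⌊log₂⌋-mono-≤ (^-monoˡ-≤ c h) ⟩
  ⌊log₂ m ^ c ⌋ ∎
  where open ≤-Reasoning

n<2^n : ∀ n → n < 2 ^ n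
n<2^n zero    = s≤s z≤n
n<2^n (suc n) = +-mono-≤ (m^n>0 2 n) (≤-trans (n<2^n n) (m≤m+n (2 ^ n) 0))

collective : ∀ {n} (G : Graph n) k ρ → Connected G → Halving G k ρ →
  Σ[ 𝒯 ∈ List (Graph n) ]
    IsCollectiveSystem G ⌊ k ·[1+log₂ n ]⌋ ⌊ 2 * ρ ·[1+log₂ n ]⌋ 𝒯 ×
    map adj 𝒯 ≡ main k (adj G)
collective {n} G k ρ connected halving = 𝒯 , (few , spanning , spanner) , trees≡
  where
  open Algorithm G k ρ connected halving
  open Invariant (invariant n)
  few : length 𝒯 ≤ ⌊ k ·[1+log₂ n ]⌋
  few = ≤-trans (≤-reflexive (trans length≡ (*-comm level k))) (2^≤⇒≤log k level≤)
  trees≡ : map adj 𝒯 ≡ main k (adj G)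
  trees≡ = trans 𝒯≡ (cong proj₂ (sym (foldFin-const n (advance k (adj G)) ((λ _ → true) , []))))
  -- A vertex still active after n rounds would make `level` equal to n and force 2 ^ n ≤ n.
  exhausted : ∀ {u} → ¬ T (A u)
  exhausted {u} u∈ = <⇒≱ (n<2^n n) (begin
    2 ^ n     ≡⟨ cong (2 ^_) (sym (level≡ (anyFin⁺ u u∈))) ⟩
    2 ^ level ≡⟨ sym (*-identityʳ (2 ^ level)) ⟩
    2 ^ level * 1 ≤⟨ *-monoʳ-≤ (2 ^ level) (count-pos u (closure⁺ (restricted G A) {u} Walk.stop)) ⟩
    2 ^ level * count (closure (restrict (adj G) A) u) ≤⟨ small u∈ ⟩
    n ∎)
    where open ≤-Reasoning
  spanner : ∀ x y d → Dist G x y d →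
            Any (λ H → ∃[ e ] Dist H x y e × e ≤ d + ⌊ 2 * ρ ·[1+log₂ n ]⌋) 𝒯
  spanner x y d ((p , refl) , _) with served p
  ... | inj₁ within = contradiction (within (start∈ p)) exhausted
  ... | inj₂ (H , H∈ , q , q≤) with shortest H q
  ...   | e , dist , e≤ = lose H∈ (e , dist , (begin
    e                            ≤⟨ e≤ ⟩
    edges q                      ≤⟨ q≤ ⟩
    edges p + 2 * (level * ρ)    ≡⟨ cong (edges p +_) (solve 2 (λ x y → con 2 :* (x :* y) := con 2 :* y :* x) refl level ρ) ⟩
    edges p + 2 * ρ * level      ≤⟨ +-monoʳ-≤ (edges p) (2^≤⇒≤log (2 * ρ) level≤) ⟩
    edges p + ⌊ 2 * ρ ·[1+log₂ n ]⌋ ∎))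
    where open ≤-Reasoning

main≡sem : ∀ k {n} (R : Rel n) → main k R ≡ sem (mainₜ k) R
main≡sem k R = refl

constructs-main : ∀ k {n} (G : Graph n) P c μ r →
  eval P (encode G) ≡ map (enc mat) (sem (mainₜ k) (adj G)) × cost P (encode G) ≤ c * n ^ c →
  Σ[ 𝒯 ∈ List (Graph n) ] IsCollectiveSystem G μ r 𝒯 × map adj 𝒯 ≡ main k (adj G) →
  Constructs P c G μ r
constructs-main k G P c μ r (evaluates , cheap) (𝒯 , system , trees≡) =
  𝒯 , system
  , trans evaluates (trans (cong (map (enc mat)) (sym (trans trees≡ (main≡sem k (adj G)))))
                           (sym (map-∘ {g = enc mat} {f = adj} 𝒯)))
  , cheap

theorem9 : (k : ℕ) → 1 ≤ k →
    Σ[ P ∈ Prog matrix (list matrix) ] ∃[ c ]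
    ((t : ℕ) → 1 ≤ t →
    (n : ℕ) (G : Graph n) → Connected G →
    (∃[ H ] IsSpanner t G H × HasTreeWidth H (k ∸ 1)) →
    Constructs P c G
    ⌊ k ·[1+log₂ n ]⌋
    ⌊ 2 * ⌈ t /2⌉ ·[1+log₂ n ]⌋)
theorem9 k 1≤k = proj₁ compiled , proj₁ (proj₂ compiled) , construct
  where
  -- The program and its constant depend on k alone, so they serve all t, n and G.
  compiled = compile-polynomial (mainₜ k)
  construct : (t : ℕ) → 1 ≤ t → (n : ℕ) (G : Graph n) → Connected G →
    (∃[ H ] IsSpanner t G H × HasTreeWidth H (k ∸ 1)) →
    Constructs (proj₁ compiled) (proj₁ (proj₂ compiled)) G
      ⌊ k ·[1+log₂ n ]⌋ ⌊ 2 * ⌈ t /2⌉ ·[1+log₂ n ]⌋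
  construct t _ n G connected (H , spanner , ((D , width≡) , _)) =
    constructs-main k G (proj₁ compiled) (proj₁ (proj₂ compiled)) _ _
      (proj₂ (proj₂ compiled) n {{proj₁ connected}} (adj G))
      (collective G k ⌈ t /2⌉ connected
        (separators⇒halving G k ⌈ t /2⌉ (proj₁ connected)
          (Separator.separator G H t k 1≤k connected spanner D width≡)))
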